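{- Let $r$ be a positive integer and let $\epsilon>0$. Then there exists a constant $\kappa=\kappa(r,\epsilon)>0$, depending only on $r$ and $\epsilon$, such that the following holds. For every integer $n\ge 2$ there exist $k\le \kappa\ln n$ linear forms $\ell_1,\ldots,\ell_k:\mathbb{R}^n\to\mathbb{R}$ such that, writing the homogeneous polynomial $$\tilde h_r(\mathbf{x})=\sum_{i=1}^k \ell_i(\mathbf{x})^r=\sum_{\substack{\alpha_1,\ldots,\alpha_n\ge 0\\ \alpha_1+\cdots+\alpha_n=r}}\tilde h_{r,a}\,\mathbf{x}^a$$ in the monomial basis, one has $$(1-\epsilon)^r\le \tilde h_{r,a}\le (1+\epsilon)^r$$ for all non-negative integer vectors $a=(\alpha_1,\ldots,\alpha_n)$ with $\alpha_1+\cdots+\alpha_n=r$.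
   Context: For $\mathbf{x}=(x_1,\ldots,x_n)$ and a non-negative integer vector $a=(\alpha_1,\ldots,\alpha_n)$, $\mathbf{x}^a=x_1^{\alpha_1}\cdots x_n^{\alpha_n}$. A linear form is a homogeneous linear function $\mathbb{R}^n\to\mathbb{R}$. -}

module Defs where

open import Level using (0ℓ)
open import Algebra.Bundles using (CommutativeRing; Semiring)
open import Algebra.Module.Bundles.Raw using (RawLeftModule)
open import Algebra.Module.Construct.TensorUnit using (rawLeftModule)
open import Algebra.Module.Morphism.Structures using (module LeftModuleMorphisms)
open import Data.Empty using (⊥; ⊥-elim)
open import Data.Integer.Base as ℤ using (+_; -[1+_])
import Data.Integer.Properties as ℤ
open import Data.List.Base using (List; []; _∷_; foldr; map; concatMap; upTo)
open import Data.List.Membership.Propositional using (_∈_; find; lose)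
import Data.List.Membership.Propositional.Properties as ∈
open import Data.List.Relation.Unary.Any using (here)
open import Data.List.Relation.Unary.All as All using ([]; _∷_)
import Data.List.Relation.Unary.All.Properties as All
open import Data.List.Relation.Unary.AllPairs using ([]; _∷_)
import Data.List.Relation.Unary.AllPairs.Properties as AllPairs
open import Data.List.Relation.Unary.Unique.Propositional using (Unique)
import Data.List.Relation.Unary.Unique.Propositional.Properties as Unique
open import Data.Nat.Base as ℕ using (ℕ; zero; suc; z≤n; s≤s)
import Data.Nat.Properties as ℕ
open import Data.Product.Base using (∃-syntax; _×_; _,_; proj₁; proj₂)
open import Data.Rational.Base as ℚ using (ℚ; mkℚ; 0ℚ; 1ℚ; ½; ∣_∣; _/_; toℚᵘ; fromℚᵘ)
import Data.Rational.Properties as ℚ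
open import Data.Rational.Solver using (module +-*-Solver)
open import Data.Rational.Unnormalised.Base as ℚᵘ using (mkℚᵘ; *≡*; *<*; *≤*)
import Data.Rational.Unnormalised.Properties as ℚᵘ
open import Data.Sum.Base using (inj₁; inj₂)
open import Data.Vec.Base as Vec using (Vec; []; _∷_; lookup)
import Data.Vec.Properties as Vec
open import Data.Vec.Functional using (Vector)
open import Function.Base using (_∘_)
open import Relation.Nullary using (¬_)
open import Relation.Binary.Structures using (IsEquivalence)
open import Relation.Binary.PropositionalEquality using (_≡_; refl; sym; trans; cong; cong₂; subst; subst₂; module ≡-Reasoning)
open import Algebra.Definitions.RawMonoid ℚ.+-0-rawMonoid using () renaming (_×_ to _·_)

private
  half-sum : ∀ ε → ½ ℚ.* ε ℚ.+ ½ ℚ.* ε ≡ ε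
  half-sum ε = trans (sym (ℚ.*-distribʳ-+ ε ½ ½)) (ℚ.*-identityˡ ε)

  half-pos : ∀ {ε} → 0ℚ ℚ.< ε → 0ℚ ℚ.< ½ ℚ.* ε
  half-pos {ε} ε>0 = subst (ℚ._< ½ ℚ.* ε) (ℚ.*-zeroʳ ½) (ℚ.*-monoʳ-<-pos ½ ε>0)

  triangle : ∀ {ε} p q → ∣ p ∣ ℚ.< ½ ℚ.* ε → ∣ q ∣ ℚ.< ½ ℚ.* ε → ∣ p ℚ.+ q ∣ ℚ.< ε
  triangle {ε} p q p< q< = subst (∣ p ℚ.+ q ∣ ℚ.<_) (half-sum ε)
    (ℚ.≤-<-trans (ℚ.∣p+q∣≤∣p∣+∣q∣ p q) (ℚ.+-mono-< p< q<))

  swap-diff : ∀ p q → ∣ p ℚ.- q ∣ ≡ ∣ q ℚ.- p ∣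
  swap-diff p q = trans (cong ∣_∣ (solve 2 (λ a b → a :- b := :- (b :- a)) refl p q)) (ℚ.∣-p∣≡∣p∣ (q ℚ.- p))
    where open +-*-Solver

  trans-diff : ∀ p q r → (p ℚ.- q) ℚ.+ (q ℚ.- r) ≡ p ℚ.- r
  trans-diff = solve 3 (λ a b c → (a :- b) :+ (b :- c) := a :- c) refl
    where open +-*-Solver

  +-diff : ∀ p q r s → (p ℚ.- r) ℚ.+ (q ℚ.- s) ≡ (p ℚ.+ q) ℚ.- (r ℚ.+ s)
  +-diff = solve 4 (λ a b c d → (a :- c) :+ (b :- d) := (a :+ b) :- (c :+ d)) refl
    where open +-*-Solver

  *-diff : ∀ p q r s → p ℚ.* (q ℚ.- s) ℚ.+ s ℚ.* (p ℚ.- r) ≡ (p ℚ.* q) ℚ.- (r ℚ.* s)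
  *-diff = solve 4 (λ a b c d → a :* (b :- d) :+ d :* (a :- c) := (a :* b) :- (c :* d)) refl
    where open +-*-Solver

  neg-diff : ∀ p q → ∣ p ℚ.- q ∣ ≡ ∣ ℚ.- p ℚ.- ℚ.- q ∣
  neg-diff p q = trans (swap-diff p q) (cong ∣_∣ (solve 2 (λ a b → b :- a := :- a :- :- b) refl p q))
    where open +-*-Solver

  -- δ with B * δ = ε / 2
  scaled : (ε B : ℚ) → 0ℚ ℚ.< ε → 0ℚ ℚ.< B → ∃[ δ ] 0ℚ ℚ.< δ × B ℚ.* δ ≡ ½ ℚ.* ε
  scaled ε B ε>0 B>0 = δ , ℚ.positive⁻¹ δ , Bδ
    where
    instance
      B-pos = ℚ.positive B>0
      B≢0 = ℚ.pos⇒nonZero B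
      1/B-pos = ℚ.1/pos⇒pos B
      h-pos = ℚ.positive (half-pos ε>0)
    δ = (ℚ.1/ B) ℚ.* (½ ℚ.* ε)
    instance
      δ-pos = ℚ.pos*pos⇒pos (ℚ.1/ B) (½ ℚ.* ε)
    Bδ : B ℚ.* δ ≡ ½ ℚ.* ε
    Bδ = trans (sym (ℚ.*-assoc B (ℚ.1/ B) (½ ℚ.* ε)))
      (trans (cong (ℚ._* (½ ℚ.* ε)) (ℚ.*-inverseʳ B)) (ℚ.*-identityˡ (½ ℚ.* ε)))

  *-small : ∀ p q {B δ} → 0ℚ ℚ.< B → ∣ p ∣ ℚ.< B → ∣ q ∣ ℚ.< δ → ∣ p ℚ.* q ∣ ℚ.< B ℚ.* δ
  *-small p q {B} {δ} B>0 p<B q<δ = subst (ℚ._< B ℚ.* δ) (sym (ℚ.∣p*q∣≡∣p∣*∣q∣ p q))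
    (ℚ.≤-<-trans (ℚ.*-monoʳ-≤-nonNeg ∣ q ∣ {{ℚ.∣-∣-nonNeg q}} (ℚ.<⇒≤ p<B))
                 (ℚ.*-monoʳ-<-pos B {{ℚ.positive B>0}} q<δ))

  *-close : ∀ p q r s {ε B δ} → 0ℚ ℚ.< B → B ℚ.* δ ≡ ½ ℚ.* ε → ∣ p ∣ ℚ.< B → ∣ s ∣ ℚ.< B →
            ∣ p ℚ.- r ∣ ℚ.< δ → ∣ q ℚ.- s ∣ ℚ.< δ → ∣ p ℚ.* q ℚ.- r ℚ.* s ∣ ℚ.< ε
  *-close p q r s {ε} B>0 eq p<B s<B p≈r q≈s = subst (λ t → ∣ t ∣ ℚ.< ε) (*-diff p q r s)
    (triangle (p ℚ.* (q ℚ.- s)) (s ℚ.* (p ℚ.- r))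
      (subst (∣ p ℚ.* (q ℚ.- s) ∣ ℚ.<_) eq (*-small p (q ℚ.- s) B>0 p<B q≈s))
      (subst (∣ s ℚ.* (p ℚ.- r) ∣ ℚ.<_) eq (*-small s (p ℚ.- r) B>0 s<B p≈r)))

  +-close : ∀ p q r s {ε} → ∣ p ℚ.- r ∣ ℚ.< ½ ℚ.* ε → ∣ q ℚ.- s ∣ ℚ.< ½ ℚ.* ε →
            ∣ (p ℚ.+ q) ℚ.- (r ℚ.+ s) ∣ ℚ.< ε
  +-close p q r s {ε} p≈r q≈s = subst (λ t → ∣ t ∣ ℚ.< ε) (+-diff p q r s)
    (triangle (p ℚ.- r) (q ℚ.- s) p≈r q≈s)

  close⇒bounded : ∀ p q → ∣ p ℚ.- q ∣ ℚ.< 1ℚ → ∣ p ∣ ℚ.< 1ℚ ℚ.+ ∣ q ∣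
  close⇒bounded p q p≈q = subst (λ t → ∣ t ∣ ℚ.< 1ℚ ℚ.+ ∣ q ∣)
    (solve 2 (λ a b → (a :- b) :+ b := a) refl p q)
    (ℚ.≤-<-trans (ℚ.∣p+q∣≤∣p∣+∣q∣ (p ℚ.- q) q) (ℚ.+-monoˡ-< ∣ q ∣ p≈q))
    where open +-*-Solver

  0<1 : 0ℚ ℚ.< 1ℚ
  0<1 = ℚ.positive⁻¹ 1ℚ

  0<1+∣_∣ : ∀ q → 0ℚ ℚ.< 1ℚ ℚ.+ ∣ q ∣
  0<1+∣ q ∣ = ℚ.+-mono-<-≤ 0<1 (ℚ.0≤∣p∣ q)

  m≤⊔ˡ : ∀ {m N} M → N ℕ.⊔ M ℕ.≤ m → N ℕ.≤ m
  m≤⊔ˡ {_} {N} M = ℕ.≤-trans (ℕ.m≤m⊔n N M)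

  m≤⊔ʳ : ∀ {m} N {M} → N ℕ.⊔ M ℕ.≤ m → M ℕ.≤ m
  m≤⊔ʳ N {M} = ℕ.≤-trans (ℕ.m≤n⊔m N M)

-- The real numbers, as Cauchy sequences of rationals. Since ∀∃ is read
-- constructively, a real carries a modulus of convergence. Arithmetic is
-- termwise, equality is that the difference tends to 0.

Cauchy : (ℕ → ℚ) → Set
Cauchy s = ∀ ε → 0ℚ ℚ.< ε → ∃[ N ] (∀ m n → N ℕ.≤ m → N ℕ.≤ n → ∣ s m ℚ.- s n ∣ ℚ.< ε)

record ℝ : Set where
  no-eta-equality
  constructor mkℝ
  field
    seq    : ℕ → ℚ
    cauchy : Cauchy seq

open ℝ public

infix 4 _≈_ _≤_ _<_

record _≈_ (x y : ℝ) : Set where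
  constructor mk≈
  field
    close : ∀ ε → 0ℚ ℚ.< ε → ∃[ N ] (∀ m → N ℕ.≤ m → ∣ seq x m ℚ.- seq y m ∣ ℚ.< ε)

record _≤_ (x y : ℝ) : Set where
  constructor mk≤
  field
    below : ∀ ε → 0ℚ ℚ.< ε → ∃[ N ] (∀ m → N ℕ.≤ m → seq x m ℚ.< seq y m ℚ.+ ε)

record _<_ (x y : ℝ) : Set where
  constructor mk<
  field
    gap       : ℚ
    gap>0     : 0ℚ ℚ.< gap
    separated : ∃[ N ] (∀ m → N ℕ.≤ m → seq x m ℚ.+ gap ℚ.< seq y m)

-- Abstract only so that conversion checking never unfolds a modulus.
abstract
  const-cauchy : ∀ q → Cauchy (λ _ → q)
  const-cauchy q ε ε>0 = 0 , λ _ _ _ _ → subst (ℚ._< ε) (sym (cong ∣_∣ (ℚ.+-inverseʳ q))) ε>0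

fromℚ : ℚ → ℝ
fromℚ q = mkℝ (λ _ → q) (const-cauchy q)

fromℕ : ℕ → ℝ
fromℕ k = fromℚ (+ k / 1)

0ℝ 1ℝ : ℝ
0ℝ = fromℚ 0ℚ
1ℝ = fromℚ 1ℚ

private
  bounded : ∀ x → ∃[ B ] 0ℚ ℚ.< B × ∃[ N ] (∀ m → N ℕ.≤ m → ∣ seq x m ∣ ℚ.< B)
  bounded x = let N , c = cauchy x 1ℚ 0<1 in
    1ℚ ℚ.+ ∣ seq x N ∣ , 0<1+∣ seq x N ∣ , N ,
    λ m N≤m → close⇒bounded (seq x m) (seq x N) (c m N N≤m ℕ.≤-refl)

  bounded₂ : ∀ x y → ∃[ B ] 0ℚ ℚ.< B × ∃[ N ] (∀ m → N ℕ.≤ m → ∣ seq x m ∣ ℚ.< B × ∣ seq y m ∣ ℚ.< B)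
  bounded₂ x y = let B , B>0 , N , x<B = bounded x ; C , C>0 , M , y<C = bounded y in
    B ℚ.⊔ C , ℚ.<-≤-trans B>0 (ℚ.p≤p⊔q B C) , N ℕ.⊔ M ,
    λ m h → ℚ.<-≤-trans (x<B m (m≤⊔ˡ M h)) (ℚ.p≤p⊔q B C) , ℚ.<-≤-trans (y<C m (m≤⊔ʳ N h)) (ℚ.p≤q⊔p B C)

abstract
  +-cauchy : ∀ x y → Cauchy (λ m → seq x m ℚ.+ seq y m)
  +-cauchy x y ε ε>0 =
    let N , cx = cauchy x (½ ℚ.* ε) (half-pos ε>0)
        M , cy = cauchy y (½ ℚ.* ε) (half-pos ε>0)
    in N ℕ.⊔ M , λ m n m≥ n≥ → +-close (seq x m) (seq y m) (seq x n) (seq y n)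
         (cx m n (m≤⊔ˡ M m≥) (m≤⊔ˡ M n≥)) (cy m n (m≤⊔ʳ N m≥) (m≤⊔ʳ N n≥))

  *-cauchy : ∀ x y → Cauchy (λ m → seq x m ℚ.* seq y m)
  *-cauchy x y ε ε>0 =
    let B , B>0 , K , xy<B = bounded₂ x y
        δ , δ>0 , Bδ       = scaled ε B ε>0 B>0
        N , cx             = cauchy x δ δ>0
        M , cy             = cauchy y δ δ>0
    in K ℕ.⊔ (N ℕ.⊔ M) , λ m n m≥ n≥ →
         *-close (seq x m) (seq y m) (seq x n) (seq y n) B>0 Bδ
           (proj₁ (xy<B m (m≤⊔ˡ (N ℕ.⊔ M) m≥))) (proj₂ (xy<B n (m≤⊔ˡ (N ℕ.⊔ M) n≥)))
           (cx m n (m≤⊔ˡ M (m≤⊔ʳ K m≥)) (m≤⊔ˡ M (m≤⊔ʳ K n≥)))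
           (cy m n (m≤⊔ʳ N (m≤⊔ʳ K m≥)) (m≤⊔ʳ N (m≤⊔ʳ K n≥)))

  neg-cauchy : ∀ x → Cauchy (λ m → ℚ.- seq x m)
  neg-cauchy x ε ε>0 = let N , c = cauchy x ε ε>0 in
    N , λ m n m≥ n≥ → subst (ℚ._< ε) (neg-diff (seq x m) (seq x n)) (c m n m≥ n≥)

infixl 6 _+_ _-_
infixl 7 _*_
infix  8 -_

_+_ : ℝ → ℝ → ℝ
x + y = mkℝ (λ m → seq x m ℚ.+ seq y m) (+-cauchy x y)

_*_ : ℝ → ℝ → ℝ
x * y = mkℝ (λ m → seq x m ℚ.* seq y m) (*-cauchy x y)

-_ : ℝ → ℝ
- x = mkℝ (λ m → ℚ.- seq x m) (neg-cauchy x)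

_-_ : ℝ → ℝ → ℝ
x - y = x + (- y)

pointwise : ∀ {x y} → (∀ m → seq x m ≡ seq y m) → x ≈ y
pointwise {x} {y} eq = mk≈ λ ε ε>0 → 0 , λ m _ →
  subst (ℚ._< ε) (sym (cong ∣_∣ (trans (cong (ℚ._- seq y m) (eq m)) (ℚ.+-inverseʳ (seq y m))))) ε>0

≈-isEquivalence : IsEquivalence _≈_
≈-isEquivalence = record
  { refl  = pointwise λ _ → refl
  ; sym   = λ {x} {y} (mk≈ p) → mk≈ λ ε ε>0 → let N , c = p ε ε>0 in
      N , λ m m≥ → subst (ℚ._< ε) (swap-diff (seq x m) (seq y m)) (c m m≥)
  ; trans = ≈-trans
  }
  where
  ≈-trans : ∀ {x y z} → x ≈ y → y ≈ z → x ≈ z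
  ≈-trans {x} {y} {z} (mk≈ p) (mk≈ q) = mk≈ λ ε ε>0 →
    let N , c = p (½ ℚ.* ε) (half-pos ε>0)
        M , d = q (½ ℚ.* ε) (half-pos ε>0)
    in N ℕ.⊔ M , λ m m≥ → subst (λ t → ∣ t ∣ ℚ.< ε) (trans-diff (seq x m) (seq y m) (seq z m))
         (triangle (seq x m ℚ.- seq y m) (seq y m ℚ.- seq z m) (c m (m≤⊔ˡ M m≥)) (d m (m≤⊔ʳ N m≥)))

+-cong : ∀ {x x′ y y′} → x ≈ x′ → y ≈ y′ → x + y ≈ x′ + y′
+-cong {x} {x′} {y} {y′} (mk≈ p) (mk≈ q) = mk≈ λ ε ε>0 →
  let N , c = p (½ ℚ.* ε) (half-pos ε>0)
      M , d = q (½ ℚ.* ε) (half-pos ε>0)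
  in N ℕ.⊔ M , λ m m≥ → +-close (seq x m) (seq y m) (seq x′ m) (seq y′ m) (c m (m≤⊔ˡ M m≥)) (d m (m≤⊔ʳ N m≥))

*-cong : ∀ {x x′ y y′} → x ≈ x′ → y ≈ y′ → x * y ≈ x′ * y′
*-cong {x} {x′} {y} {y′} (mk≈ p) (mk≈ q) = mk≈ λ ε ε>0 →
  let B , B>0 , K , b = bounded₂ x y′
      δ , δ>0 , Bδ    = scaled ε B ε>0 B>0
      N , c           = p δ δ>0
      M , d           = q δ δ>0
  in K ℕ.⊔ (N ℕ.⊔ M) , λ m m≥ → *-close (seq x m) (seq y m) (seq x′ m) (seq y′ m) B>0 Bδ
       (proj₁ (b m (m≤⊔ˡ (N ℕ.⊔ M) m≥))) (proj₂ (b m (m≤⊔ˡ (N ℕ.⊔ M) m≥)))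
       (c m (m≤⊔ˡ M (m≤⊔ʳ K m≥))) (d m (m≤⊔ʳ N (m≤⊔ʳ K m≥)))

-‿cong : ∀ {x y} → x ≈ y → - x ≈ - y
-‿cong {x} {y} (mk≈ p) = mk≈ λ ε ε>0 → let N , c = p ε ε>0 in
  N , λ m m≥ → subst (ℚ._< ε) (neg-diff (seq x m) (seq y m)) (c m m≥)

+-assoc : ∀ x y z → (x + y) + z ≈ x + (y + z)
+-assoc x y z = pointwise λ m → ℚ.+-assoc (seq x m) (seq y m) (seq z m)

+-comm : ∀ x y → x + y ≈ y + x
+-comm x y = pointwise λ m → ℚ.+-comm (seq x m) (seq y m)

+-identityˡ : ∀ x → 0ℝ + x ≈ x
+-identityˡ x = pointwise λ m → ℚ.+-identityˡ (seq x m)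

+-identityʳ : ∀ x → x + 0ℝ ≈ x
+-identityʳ x = pointwise λ m → ℚ.+-identityʳ (seq x m)

+-inverseˡ : ∀ x → (- x) + x ≈ 0ℝ
+-inverseˡ x = pointwise λ m → ℚ.+-inverseˡ (seq x m)

+-inverseʳ : ∀ x → x + (- x) ≈ 0ℝ
+-inverseʳ x = pointwise λ m → ℚ.+-inverseʳ (seq x m)

*-assoc : ∀ x y z → (x * y) * z ≈ x * (y * z)
*-assoc x y z = pointwise λ m → ℚ.*-assoc (seq x m) (seq y m) (seq z m)

*-comm : ∀ x y → x * y ≈ y * x
*-comm x y = pointwise λ m → ℚ.*-comm (seq x m) (seq y m)

*-identityˡ : ∀ x → 1ℝ * x ≈ x
*-identityˡ x = pointwise λ m → ℚ.*-identityˡ (seq x m)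

*-identityʳ : ∀ x → x * 1ℝ ≈ x
*-identityʳ x = pointwise λ m → ℚ.*-identityʳ (seq x m)

*-distribˡ-+ : ∀ x y z → x * (y + z) ≈ x * y + x * z
*-distribˡ-+ x y z = pointwise λ m → ℚ.*-distribˡ-+ (seq x m) (seq y m) (seq z m)

*-distribʳ-+ : ∀ x y z → (y + z) * x ≈ y * x + z * x
*-distribʳ-+ x y z = pointwise λ m → ℚ.*-distribʳ-+ (seq x m) (seq y m) (seq z m)

ℝ-commutativeRing : CommutativeRing 0ℓ 0ℓ
ℝ-commutativeRing = record
  { Carrier = ℝ ; _≈_ = _≈_ ; _+_ = _+_ ; _*_ = _*_ ; -_ = -_ ; 0# = 0ℝ ; 1# = 1ℝ
  ; isCommutativeRing = record
    { isRing = record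
      { +-isAbelianGroup = record
        { isGroup = record
          { isMonoid = record
            { isSemigroup = record
              { isMagma = record { isEquivalence = ≈-isEquivalence ; ∙-cong = +-cong }
              ; assoc   = +-assoc
              }
            ; identity = +-identityˡ , +-identityʳ
            }
          ; inverse = +-inverseˡ , +-inverseʳ
          ; ⁻¹-cong = -‿cong
          }
        ; comm = +-comm
        }
      ; *-cong     = *-cong
      ; *-assoc    = *-assoc
      ; *-identity = *-identityˡ , *-identityʳ
      ; distrib    = *-distribˡ-+ , *-distribʳ-+
      }
    ; *-comm = *-comm
    }
  }

open import Algebra.Definitions.RawSemiring (Semiring.rawSemiring (CommutativeRing.semiring ℝ-commutativeRing)) public using (_^_; sum; product)

harmonic : ℕ → ℚ
harmonic zero    = 0ℚ
harmonic (suc k) = harmonic k ℚ.+ + 1 / suc k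

private
  frac-≡ : ∀ a b c d → a ℕ.* suc d ≡ c ℕ.* suc b → + a / suc b ≡ + c / suc d
  frac-≡ a b c d eq = ℚ.fromℚᵘ-cong {mkℚᵘ (+ a) b} {mkℚᵘ (+ c) d}
    (*≡* (trans (sym (ℤ.pos-* a (suc d))) (trans (cong +_ eq) (ℤ.pos-* c (suc b)))))

  recip-≤ : ∀ {j k} → j ℕ.≤ k → + 1 / suc k ℚ.≤ + 1 / suc j
  recip-≤ {j} {k} j≤k = ℚ.toℚᵘ-cancel-≤
    (ℚᵘ.≤-respˡ-≃ (ℚᵘ.≃-sym (ℚ.toℚᵘ-fromℚᵘ (mkℚᵘ (+ 1) k)))
      (ℚᵘ.≤-respʳ-≃ (ℚᵘ.≃-sym (ℚ.toℚᵘ-fromℚᵘ (mkℚᵘ (+ 1) j)))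
        (*≤* (ℤ.*-monoˡ-≤-nonNeg (+ 1) (ℤ.+≤+ (s≤s j≤k))))))

  recip-pos : ∀ k → 0ℚ ℚ.≤ + 1 / suc k
  recip-pos k = ℚ.nonNegative⁻¹ (+ 1 / suc k) {{ℚ.normalize-nonNeg 1 (suc k)}}

  archimedean : ∀ ε → 0ℚ ℚ.< ε → ∃[ k ] + 1 / suc k ℚ.< ε
  archimedean ε@(mkℚ (+ zero) _ _) (ℚ.*<* ε>0) = ⊥-elim (ℤ.<-irrefl refl ε>0)
  archimedean ε@(mkℚ -[1+ _ ] _ _) (ℚ.*<* ())
  archimedean ε@(mkℚ (+ suc n) d _) _ = suc d , ℚ.toℚᵘ-cancel-<
    (ℚᵘ.<-respˡ-≃ (ℚᵘ.≃-sym (ℚ.toℚᵘ-fromℚᵘ (mkℚᵘ (+ 1) (suc d))))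
      (*<* (ℤ.+<+ (ℕ.<-≤-trans (ℕ.≤-reflexive (cong suc (ℕ.+-identityʳ (suc d)))) (ℕ.m≤m+n _ _)))))

  frac-+ : ∀ n k → + 1 / suc k ℚ.+ + n / suc k ≡ + suc n / suc k
  frac-+ n k = ℚ.toℚᵘ-injective (ℚᵘ.≃-trans (ℚ.toℚᵘ-homo-+ (+ 1 / suc k) (+ n / suc k))
    (ℚᵘ.≃-trans (ℚᵘ.+-cong (ℚ.toℚᵘ-fromℚᵘ (mkℚᵘ (+ 1) k)) (ℚ.toℚᵘ-fromℚᵘ (mkℚᵘ (+ n) k)))
      (ℚᵘ.≃-trans (*≡* eq) (ℚᵘ.≃-sym (ℚ.toℚᵘ-fromℚᵘ (mkℚᵘ (+ suc n) k))))))
    where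
    open ≡-Reasoning
    K = + suc k
    eq : (+ 1 ℤ.* K ℤ.+ + n ℤ.* K) ℤ.* K ≡ + suc n ℤ.* (+ (suc k ℕ.* suc k))
    eq = begin
      (+ 1 ℤ.* K ℤ.+ + n ℤ.* K) ℤ.* K ≡⟨ cong (ℤ._* K) (sym (ℤ.*-distribʳ-+ K (+ 1) (+ n))) ⟩
      (+ suc n ℤ.* K) ℤ.* K           ≡⟨ ℤ.*-assoc (+ suc n) K K ⟩
      + suc n ℤ.* (K ℤ.* K)           ≡⟨ cong (+ suc n ℤ.*_) (sym (ℤ.pos-* (suc k) (suc k))) ⟩
      + suc n ℤ.* (+ (suc k ℕ.* suc k)) ∎

  ·-recip : ∀ n k → n · (+ 1 / suc k) ≡ + n / suc k
  ·-recip zero    k = sym (ℚ.0/n≡0 (suc k))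
  ·-recip (suc n) k = trans (cong (+ 1 / suc k ℚ.+_) (·-recip n k)) (frac-+ n k)

  block : ∀ n k j → suc k ≡ n ℕ.* suc j → n · (+ 1 / suc k) ≡ + 1 / suc j
  block n k j eq = trans (·-recip n k) (frac-≡ n k 1 j (trans (sym eq) (sym (ℕ.*-identityˡ (suc k)))))

  block-≥ : ∀ n a c → (∀ k → k ℕ.< n → c ℚ.≤ + 1 / suc (k ℕ.+ a)) → harmonic a ℚ.+ n · c ℚ.≤ harmonic (n ℕ.+ a)
  block-≥ zero    a c _ = ℚ.≤-reflexive (ℚ.+-identityʳ (harmonic a))
  block-≥ (suc n) a c h = subst (ℚ._≤ harmonic (suc n ℕ.+ a))
    (solve 3 (λ x y z → (x :+ y) :+ z := x :+ (z :+ y)) refl (harmonic a) (n · c) c)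
    (ℚ.+-mono-≤ (block-≥ n a c (λ k k<n → h k (ℕ.m<n⇒m<1+n k<n))) (h n ℕ.≤-refl))
    where open +-*-Solver

  block-≤ : ∀ n a c → (∀ k → k ℕ.< n → + 1 / suc (k ℕ.+ a) ℚ.≤ c) → harmonic (n ℕ.+ a) ℚ.≤ harmonic a ℚ.+ n · c
  block-≤ zero    a c _ = ℚ.≤-reflexive (sym (ℚ.+-identityʳ (harmonic a)))
  block-≤ (suc n) a c h = subst (harmonic (suc n ℕ.+ a) ℚ.≤_)
    (solve 3 (λ x y z → (x :+ y) :+ z := x :+ (z :+ y)) refl (harmonic a) (n · c) c)
    (ℚ.+-mono-≤ (block-≤ n a c (λ k k<n → h k (ℕ.m<n⇒m<1+n k<n))) (h n ℕ.≤-refl))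
    where open +-*-Solver

  cancel-block : ∀ a b r → (a ℚ.+ r) ℚ.- (b ℚ.+ r) ≡ a ℚ.- b
  cancel-block = solve 3 (λ a b r → (a :+ r) :- (b :+ r) := a :- b) refl
    where open +-*-Solver

-- Right-endpoint Riemann sums of ∫₁ⁿ dt/t with mesh 1/m, where m = suc q:
-- Σ_{j=m+1}^{nm} (1/m) · 1/(j/m) = harmonic (n m) - harmonic m.
lnSum : ℕ → ℕ → ℚ
lnSum n q = harmonic (n ℕ.* suc q) ℚ.- harmonic (suc q)

private
  -- Left-endpoint sums, for n = suc p.
  upper : ℕ → ℕ → ℚ
  upper p q = harmonic (q ℕ.+ p ℕ.* suc q) ℚ.- harmonic q

  lower-step : ∀ p q → lnSum (suc p) q ℚ.≤ lnSum (suc p) (suc q)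
  lower-step p q = subst₂ ℚ._≤_ (cancel-block (harmonic a) (harmonic (suc q)) r)
    (cong (λ t → harmonic t ℚ.- harmonic (suc (suc q))) (sym (ℕ.*-suc (suc p) (suc q))))
    (ℚ.+-monoˡ-≤ (ℚ.- (harmonic (suc q) ℚ.+ r))
      (subst (λ t → harmonic a ℚ.+ t ℚ.≤ harmonic (suc p ℕ.+ a))
        (block (suc p) (p ℕ.+ a) (suc q) (sym (ℕ.*-suc (suc p) (suc q))))
        (block-≥ (suc p) a c λ k k<n → recip-≤ (ℕ.+-monoˡ-≤ a (ℕ.≤-pred k<n)))))
    where
    a = suc p ℕ.* suc q
    c = + 1 / suc (p ℕ.+ a)
    r = + 1 / suc (suc q)

  upper-step : ∀ p q → upper p (suc q) ℚ.≤ upper p q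
  upper-step p q = subst₂ ℚ._≤_
    (cong (λ t → harmonic t ℚ.- harmonic (suc q)) (ℕ.suc-injective (sym (ℕ.*-suc (suc p) (suc q)))))
    (cancel-block (harmonic a) (harmonic q) r)
    (ℚ.+-monoˡ-≤ (ℚ.- (harmonic q ℚ.+ r))
      (subst (harmonic (p ℕ.+ suc a) ℚ.≤_) (cong (harmonic a ℚ.+_) (block (suc p) a q refl))
        (subst (λ t → harmonic t ℚ.≤ harmonic a ℚ.+ suc p · c) (sym (ℕ.+-suc p a))
          (block-≤ (suc p) a c λ k _ → recip-≤ (ℕ.m≤n+m a k)))))
    where
    a = q ℕ.+ p ℕ.* suc q
    c = + 1 / suc a
    r = + 1 / suc q

  regroup : ∀ a b c r → ((a ℚ.+ c) ℚ.- (b ℚ.+ r)) ℚ.+ r ≡ (a ℚ.- b) ℚ.+ c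
  regroup = solve 4 (λ a b c r → ((a :+ c) :- (b :+ r)) :+ r := (a :- b) :+ c) refl
    where open +-*-Solver

  regroup′ : ∀ a b c r → ((a ℚ.- b) ℚ.+ c) ℚ.- r ≡ (a ℚ.+ c) ℚ.- (b ℚ.+ r)
  regroup′ = solve 4 (λ a b c r → ((a :- b) :+ c) :- r := (a :+ c) :- (b :+ r)) refl
    where open +-*-Solver

  upper≤lower+mesh : ∀ p q → upper p q ℚ.≤ lnSum (suc p) q ℚ.+ + 1 / suc q
  upper≤lower+mesh p q = subst (upper p q ℚ.≤_) (sym (regroup (harmonic a) (harmonic q) c r))
    (subst (ℚ._≤ upper p q ℚ.+ c) (ℚ.+-identityʳ (upper p q)) (ℚ.+-monoʳ-≤ (upper p q) (recip-pos a)))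
    where
    a = q ℕ.+ p ℕ.* suc q
    c = + 1 / suc a
    r = + 1 / suc q

  lower≤upper : ∀ p q → lnSum (suc p) q ℚ.≤ upper p q
  lower≤upper p q = subst₂ ℚ._≤_ (regroup′ (harmonic a) (harmonic q) c r)
    (trans (ℚ.+-assoc (upper p q) r (ℚ.- r)) (trans (cong (upper p q ℚ.+_) (ℚ.+-inverseʳ r)) (ℚ.+-identityʳ (upper p q))))
    (ℚ.+-monoˡ-≤ (ℚ.- r) (ℚ.+-monoʳ-≤ (upper p q) (recip-≤ (ℕ.m≤m+n q (p ℕ.* suc q)))))
    where
    a = q ℕ.+ p ℕ.* suc q
    c = + 1 / suc a
    r = + 1 / suc q

  lower-mono : ∀ p {q q′} → q ℕ.≤ q′ → lnSum (suc p) q ℚ.≤ lnSum (suc p) q′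
  lower-mono p = mono′ ∘ ℕ.≤⇒≤′
    where
    mono′ : ∀ {q q′} → q ℕ.≤′ q′ → lnSum (suc p) q ℚ.≤ lnSum (suc p) q′
    mono′ ℕ.≤′-refl       = ℚ.≤-refl
    mono′ {q} (ℕ.≤′-step {q′} h) = ℚ.≤-trans (mono′ h) (lower-step p q′)

  upper-anti : ∀ p {q q′} → q ℕ.≤ q′ → upper p q′ ℚ.≤ upper p q
  upper-anti p = anti′ ∘ ℕ.≤⇒≤′
    where
    anti′ : ∀ {q q′} → q ℕ.≤′ q′ → upper p q′ ℚ.≤ upper p q
    anti′ ℕ.≤′-refl       = ℚ.≤-refl
    anti′ {q} (ℕ.≤′-step {q′} h) = ℚ.≤-trans (upper-step p q′) (anti′ h)

  lower-within : ∀ p {q q′} → q ℕ.≤ q′ → lnSum (suc p) q′ ℚ.≤ lnSum (suc p) q ℚ.+ + 1 / suc q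
  lower-within p {q} {q′} q≤q′ = ℚ.≤-trans (lower≤upper p q′)
    (ℚ.≤-trans (upper-anti p q≤q′) (upper≤lower+mesh p q))

  diff-≤ : ∀ {s t l r} → l ℚ.≤ t → s ℚ.≤ l ℚ.+ r → s ℚ.- t ℚ.≤ r
  diff-≤ {s} {t} {l} {r} l≤t s≤l+r = subst (s ℚ.- t ℚ.≤_)
    (solve 2 (λ l r → (l :+ r) :- l := r) refl l r) (ℚ.+-mono-≤ s≤l+r (ℚ.neg-antimono-≤ l≤t))
    where open +-*-Solver

  ∣diff∣-≤ : ∀ {s t l r} → l ℚ.≤ s → l ℚ.≤ t → s ℚ.≤ l ℚ.+ r → t ℚ.≤ l ℚ.+ r → ∣ s ℚ.- t ∣ ℚ.≤ r
  ∣diff∣-≤ {s} {t} {l} {r} l≤s l≤t s≤ t≤ with ℚ.∣p∣≡p∨∣p∣≡-p (s ℚ.- t)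
  ... | inj₁ eq = subst (ℚ._≤ r) (sym eq) (diff-≤ l≤t s≤)
  ... | inj₂ eq = subst (ℚ._≤ r) (sym (trans eq (solve 2 (λ s t → :- (s :- t) := t :- s) refl s t))) (diff-≤ l≤s t≤)
    where open +-*-Solver

abstract
  lnSum-cauchy : ∀ p → Cauchy (lnSum (suc p))
  lnSum-cauchy p ε ε>0 = let N , 1/N<ε = archimedean ε ε>0 in
    N , λ m n m≥ n≥ → ℚ.≤-<-trans
      (∣diff∣-≤ (lower-mono p m≥) (lower-mono p n≥) (lower-within p m≥) (lower-within p n≥)) 1/N<ε

-- ln n = ∫₁ⁿ dt/t. The value at 0 is a dummy.
ln : ℕ → ℝ
ln zero    = 0ℝ
ln (suc p) = mkℝ (lnSum (suc p)) (lnSum-cauchy p)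

ℝ^-rawLeftModule : ℕ → RawLeftModule ℝ 0ℓ 0ℓ
ℝ^-rawLeftModule n = record
  { Carrierᴹ = Vector ℝ n
  ; _≈ᴹ_     = λ x y → ∀ i → x i ≈ y i
  ; _+ᴹ_     = λ x y i → x i + y i
  ; _*ₗ_     = λ c x i → c * x i
  ; 0ᴹ       = λ _ → 0ℝ
  ; -ᴹ_      = λ x i → - x i
  }

ℝ-rawLeftModule : RawLeftModule ℝ 0ℓ 0ℓ
ℝ-rawLeftModule = rawLeftModule {R = CommutativeRing.rawRing ℝ-commutativeRing}

record LinearForm (n : ℕ) : Set where
  open LeftModuleMorphisms (ℝ^-rawLeftModule n) ℝ-rawLeftModule
  field
    ⟦_⟧      : Vector ℝ n → ℝ
    isLinear : IsLeftModuleHomomorphism ⟦_⟧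

open LinearForm public using (⟦_⟧)

monomial : ∀ {n} → Vector ℝ n → Vec ℕ n → ℝ
monomial x a = product (λ i → x i ^ lookup a i)

-- All a : Vec ℕ n with Vec.sum a ≡ r, each once; the three lemmas below
-- prove it.
multiIndices : (n r : ℕ) → List (Vec ℕ n)
multiIndices zero    zero    = [] ∷ []
multiIndices zero    (suc r) = []
multiIndices (suc n) r       = concatMap (λ i → map (i ∷_) (multiIndices n (r ℕ.∸ i))) (upTo (suc r))

∈-multiIndices⁻ : ∀ n {r a} → a ∈ multiIndices n r → Vec.sum a ≡ r
∈-multiIndices⁻ zero {zero} (here refl) = refl
∈-multiIndices⁻ (suc n) {r} a∈
  with find (∈.∈-concatMap⁻ (λ i → map (i ∷_) (multiIndices n (r ℕ.∸ i))) {upTo (suc r)} a∈)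
... | i , i∈ , a∈map with ∈.∈-map⁻ (i ∷_) a∈map
... | b , b∈ , refl = trans (cong (i ℕ.+_) (∈-multiIndices⁻ n b∈)) (ℕ.m+[n∸m]≡n (ℕ.≤-pred (∈.∈-upTo⁻ i∈)))

∈-multiIndices⁺ : ∀ {n r} (a : Vec ℕ n) → Vec.sum a ≡ r → a ∈ multiIndices n r
∈-multiIndices⁺ [] refl = here refl
∈-multiIndices⁺ (i ∷ a) refl = ∈.∈-concatMap⁺ _
  (lose (∈.∈-upTo⁺ (s≤s (ℕ.m≤m+n i (Vec.sum a))))
    (∈.∈-map⁺ (i ∷_) (∈-multiIndices⁺ a (sym (ℕ.m+n∸m≡n i (Vec.sum a))))))

multiIndices-unique : ∀ n r → Unique (multiIndices n r)
multiIndices-unique zero    zero    = [] ∷ []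
multiIndices-unique zero    (suc r) = []
multiIndices-unique (suc n) r       = Unique.concat⁺
  (All.map⁺ (All.universal (λ i → Unique.map⁺ Vec.∷-injectiveʳ (multiIndices-unique n (r ℕ.∸ i))) (upTo (suc r))))
  (AllPairs.map⁺ (AllPairs.applyUpTo⁺₁ _ (suc r) λ {i} {j} i<j _ (∈i , ∈j) → disjoint i j (ℕ.<⇒≢ i<j) ∈i ∈j))
  where
  disjoint : ∀ i j {a : Vec ℕ (suc n)} {as bs} → ¬ (i ≡ j) → a ∈ map (i ∷_) as → a ∈ map (j ∷_) bs → ⊥
  disjoint i j i≢j ∈i ∈j with ∈.∈-map⁻ (i ∷_) ∈i | ∈.∈-map⁻ (j ∷_) ∈j
  ... | b , _ , eq | c , _ , eq′ = i≢j (Vec.∷-injectiveˡ (trans (sym eq) eq′))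

-- Σ_{|a| = r} h a · x^a
homogeneous : ∀ {n} (r : ℕ) → (Vec ℕ n → ℝ) → Vector ℝ n → ℝ
homogeneous {n} r h x = foldr _+_ 0ℝ (map (λ a → h a * monomial x a) (multiIndices n r))

{-# OPTIONS --safe #-}
module Submission where

-- Independent exponential variables satisfy E Π X_j^{α_j} = Π α_j!, so
-- averaging (Σ x_j X_j)^r / r! gives all coefficients equal to 1. To use only
-- O(log n) forms, replace the exponential law by the uniform law on a finite
-- multiset Z of naturals with nearly proportional moments, and derandomise:
-- take a code of n words of length O(log n) over an alphabet of constant size
-- d in which any two words agree in a small fraction of the positions. For a
-- position i and t ∈ Z^d, the form Σ_j t(c_j(i)) x_j gives x_j the value
-- attached to the i-th letter of the j-th word. Summing over t, position i
-- contributes about Π_s b_s! / a!, where b collects the exponents that share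
-- a letter. This ratio lies between 1 and r!, and is 1 unless two variables
-- of x^a collide at i, which happens at few positions.

-- Scaling a form by y multiplies its r-th power by y^r, so for even r no scaling produces a
-- negative weight, and a positive weight costs an r-th root. Uniform averages avoid weights
-- altogether: a multiplicity in Z becomes a repeated form, and a single scale common to all forms
-- does the normalising. Even this scale would in general be an irrational r-th root; the code
-- length is therefore padded until the scale is rational, which costs only a constant factor in the
-- number of forms. The estimates stay in the naturals, with relative errors measured by (t + 1) /
-- t. The lower bound on a coefficient loses only through the inexact moments, the upper bound only
-- through collisions, and each loss is at most ((t + 1) / t)^r. The extreme coefficients thus
-- differ by a factor of at most ((t + 1) / t)^(2r), and `t` is chosen large enough in terms of ε
-- for this range to fit.

module Combinatorics where

  open import Data.Nat.Properties
  open import Algebra.Properties.CommutativeMonoid.Sum *-1-commutativeMonoid using ()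
    renaming (sum to ∏; sum-cong-≗ to ∏-cong; ∑-distrib-+ to ∏-distrib-*)
  open import Algebra.Properties.Semiring.Sum +-*-semiring using (*-distribˡ-sum; *-distribʳ-sum; ∑-distrib-+; ∑-comm)
    renaming (sum to ∑; sum-cong-≗ to ∑-cong)
  open import Data.Bool.Base using (if_then_else_)
  open import Data.Fin.Base as Fin using (Fin; zero; suc)
  open import Data.Fin.Properties using () renaming (_≟_ to _≟ᶠ_)
  open import Data.List.Base using (List; []; _∷_; _++_; map; length; cartesianProductWith; allFin; tabulate)
  open import Data.List.Properties using (map-++; map-∘; map-cong; length-++; length-map; map-tabulate; length-tabulate)
  open import Data.Nat.Base
  open import Data.Nat.Combinatorics using (nCk≡n!/k![n-k]!; k![n∸k]!∣n!) renaming (_C_ to _choose_)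
  open import Data.Nat.DivMod using (m/n*n≡m)
  open import Data.Nat.ListAction using (sum)
  open import Data.Nat.ListAction.Properties using (sum-++)
  open import Data.Nat.Solver using (module +-*-Solver)
  open import Data.Product.Base using (∃-syntax; _×_; _,_; proj₁; proj₂)
  open import Data.Sum.Base using (inj₁; inj₂)
  open import Data.Vec.Base as Vec using (Vec; []; _∷_; lookup)
  open import Data.Vec.Functional as Vector using (Vector)
  open import Function.Base using (_∘_)
  open import Relation.Binary.PropositionalEquality using (_≡_; _≗_; refl; sym; trans; cong; cong₂; subst; subst₂; module ≡-Reasoning)
  open import Relation.Nullary using (does; yes; no; contradiction)

  open +-*-Solver using (solve; _:=_; _:+_; _:*_; con)

  private variable m n K : ℕ

  -- Moments of a discretised exponential law.

  ∑ˡ : ∀ {A : Set} → List A → (A → ℕ) → ℕ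
  ∑ˡ xs f = sum (map f xs)

  ∑ˡ-++ : ∀ {A : Set} (xs ys : List A) f → ∑ˡ (xs ++ ys) f ≡ ∑ˡ xs f + ∑ˡ ys f
  ∑ˡ-++ xs ys f = trans (cong sum (map-++ f xs ys)) (sum-++ (map f xs) (map f ys))

  moment : List ℕ → ℕ → ℕ
  moment Z j = ∑ˡ Z (_^ j)

  -- Z = points M D contains z ≤ D with multiplicity C(D - z + M - 1, M - 1).
  -- This discretises the density (1 - z/D)^(M-1), close to exp(-Mz/D).
  points : ℕ → ℕ → List ℕ
  points zero    D       = D ∷ []
  points (suc M) zero    = 0 ∷ []
  points (suc M) (suc D) = points (suc M) D ++ points M (suc D)

  -- As a function of `D` this is the power `D ^ j` summed `M` times over, each time from 0 to `D`.
  -- It is the discrete analogue of an iterated integral, which is why one more summation trades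
  -- against one power.
  powerSum : ℕ → ℕ → ℕ → ℕ
  powerSum j M D = moment (points M D) j

  powerSum-step : ∀ j M D → powerSum j (suc M) (suc D) ≡ powerSum j (suc M) D + powerSum j M (suc D)
  powerSum-step j M D = ∑ˡ-++ (points (suc M) D) (points M (suc D)) (_^ j)

  powerSum-zero : ∀ j M → powerSum j M 0 ≡ 0 ^ j
  powerSum-zero j zero    = +-identityʳ (0 ^ j)
  powerSum-zero j (suc M) = +-identityʳ (0 ^ j)

  -- Together with `pow-step-≤` this traps the forward difference of a power between the values of
  -- its derivative at the two endpoints.
  pow-step-≥ : ∀ j d → d ^ suc j + suc j * d ^ j ≤ suc d ^ suc j
  pow-step-≥ zero    d = ≤-reflexive (solve 1 (λ d → d :* con 1 :+ con 1 := (con 1 :+ d) :* con 1) refl d)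
  pow-step-≥ (suc j) d = begin
    d * (d * e) + (2 + j) * (d * e)             ≤⟨ m≤m+n _ (suc j * e) ⟩
    d * (d * e) + (2 + j) * (d * e) + suc j * e ≡⟨ solve 3 (λ j d e → d :* (d :* e) :+ (con 2 :+ j) :* (d :* e) :+ (con 1 :+ j) :* e
                                                     := (con 1 :+ d) :* (d :* e :+ (con 1 :+ j) :* e)) refl j d e ⟩
    suc d * (d * e + suc j * e)                 ≤⟨ *-monoʳ-≤ (suc d) (pow-step-≥ j d) ⟩
    suc d ^ suc (suc j)                         ∎
    where
    open ≤-Reasoning
    e = d ^ j

  pow-step-≤ : ∀ j d → suc d ^ suc j ≤ d ^ suc j + suc j * suc d ^ j
  pow-step-≤ zero    d = ≤-reflexive (solve 1 (λ d → (con 1 :+ d) :* con 1 := d :* con 1 :+ con 1) refl d)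
  pow-step-≤ (suc j) d = begin
    suc d * f                             ≤⟨ *-monoʳ-≤ (suc d) (pow-step-≤ j d) ⟩
    suc d * (e + suc j * g)               ≡⟨ solve 4 (λ j d e g → (con 1 :+ d) :* (e :+ (con 1 :+ j) :* g)
                                               := d :* e :+ (e :+ (con 1 :+ j) :* ((con 1 :+ d) :* g))) refl j d e g ⟩
    d * e + (e + suc j * (suc d * g))     ≤⟨ +-monoʳ-≤ (d * e) (+-monoˡ-≤ (suc j * f) (^-monoˡ-≤ (suc j) (n≤1+n d))) ⟩
    d * e + (f + suc j * f)               ∎
    where
    open ≤-Reasoning
    e = d ^ suc j
    g = suc d ^ j
    f = suc d ^ suc j

  -- Discrete integration by parts: passing from M to suc M sums over D.
  mutual
    powerSum-step-≥ : ∀ j M D → powerSum (suc j) M D + suc j * powerSum j M D ≤ powerSum (suc j) M (suc D)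
    powerSum-step-≥ j zero D = begin
      D ^ suc j + 0 + suc j * (D ^ j + 0) ≡⟨ cong₂ _+_ (+-identityʳ (D ^ suc j)) (cong (suc j *_) (+-identityʳ (D ^ j))) ⟩
      D ^ suc j + suc j * D ^ j           ≤⟨ pow-step-≥ j D ⟩
      suc D ^ suc j                       ≡⟨ +-identityʳ (suc D ^ suc j) ⟨
      suc D ^ suc j + 0                   ∎
      where open ≤-Reasoning
    powerSum-step-≥ j (suc M) D = subst (powerSum (suc j) (suc M) D + suc j * powerSum j (suc M) D ≤_)
      (sym (powerSum-step (suc j) M D)) (+-monoʳ-≤ (powerSum (suc j) (suc M) D) (powerSum-parts-≥ j M D))

    powerSum-parts-≥ : ∀ j M D → suc j * powerSum j (suc M) D ≤ powerSum (suc j) M (suc D)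
    powerSum-parts-≥ j M zero = begin
      suc j * powerSum j (suc M) 0            ≡⟨ cong (suc j *_) (trans (powerSum-zero j (suc M)) (sym (powerSum-zero j M))) ⟩
      suc j * powerSum j M 0                  ≤⟨ m≤n+m _ (powerSum (suc j) M 0) ⟩
      powerSum (suc j) M 0 + suc j * powerSum j M 0  ≤⟨ powerSum-step-≥ j M 0 ⟩
      powerSum (suc j) M 1                    ∎
      where open ≤-Reasoning
    powerSum-parts-≥ j M (suc D) = begin
      suc j * powerSum j (suc M) (suc D)                      ≡⟨ cong (suc j *_) (powerSum-step j M D) ⟩
      suc j * (powerSum j (suc M) D + powerSum j M (suc D))          ≡⟨ *-distribˡ-+ (suc j) (powerSum j (suc M) D) _ ⟩
      suc j * powerSum j (suc M) D + suc j * powerSum j M (suc D)    ≤⟨ +-monoˡ-≤ _ (powerSum-parts-≥ j M D) ⟩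
      powerSum (suc j) M (suc D) + suc j * powerSum j M (suc D)      ≤⟨ powerSum-step-≥ j M (suc D) ⟩
      powerSum (suc j) M (suc (suc D))                        ∎
      where open ≤-Reasoning

  mutual
    powerSum-step-≤ : ∀ j M D → powerSum (suc j) M (suc D) ≤ powerSum (suc j) M D + suc j * powerSum j M (suc D)
    powerSum-step-≤ j zero D = begin
      suc D ^ suc j + 0                       ≡⟨ +-identityʳ (suc D ^ suc j) ⟩
      suc D ^ suc j                           ≤⟨ pow-step-≤ j D ⟩
      D ^ suc j + suc j * suc D ^ j           ≡⟨ cong₂ _+_ (+-identityʳ (D ^ suc j)) (cong (suc j *_) (+-identityʳ (suc D ^ j))) ⟨
      D ^ suc j + 0 + suc j * (suc D ^ j + 0) ∎
      where open ≤-Reasoning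
    powerSum-step-≤ j (suc M) D = subst (_≤ powerSum (suc j) (suc M) D + suc j * powerSum j (suc M) (suc D))
      (sym (powerSum-step (suc j) M D)) (+-monoʳ-≤ (powerSum (suc j) (suc M) D) (powerSum-parts-≤ j M (suc D)))

    powerSum-parts-≤ : ∀ j M D → powerSum (suc j) M D ≤ suc j * powerSum j (suc M) D
    powerSum-parts-≤ j M zero = ≤-trans (≤-reflexive (powerSum-zero (suc j) M)) z≤n
    powerSum-parts-≤ j M (suc D) = begin
      powerSum (suc j) M (suc D)                           ≤⟨ powerSum-step-≤ j M D ⟩
      powerSum (suc j) M D + suc j * powerSum j M (suc D)         ≤⟨ +-monoˡ-≤ _ (powerSum-parts-≤ j M D) ⟩
      suc j * powerSum j (suc M) D + suc j * powerSum j M (suc D) ≡⟨ *-distribˡ-+ (suc j) (powerSum j (suc M) D) _ ⟨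
      suc j * (powerSum j (suc M) D + powerSum j M (suc D))       ≡⟨ cong (suc j *_) (powerSum-step j M D) ⟨
      suc j * powerSum j (suc M) (suc D)                   ∎
      where open ≤-Reasoning

  -- The size of the multiset, equal to the binomial coefficient C(D + M, M). The next two lemmas
  -- are its absorption identities.
  count : ℕ → ℕ → ℕ
  count = powerSum 0

  count-absorb : ∀ M D → suc M * count (suc M) D ≡ suc D * count M (suc D)
  count-absorb zero    zero    = refl
  count-absorb (suc M) zero    = begin
    (2 + M) * 1                          ≡⟨ solve 1 (λ M → (con 2 :+ M) :* con 1 := con 1 :* ((con 1 :+ M) :* con 1 :+ con 1)) refl M ⟩
    1 * (suc M * 1 + 1)                  ≡⟨ cong (λ x → 1 * (x + 1)) (count-absorb M zero) ⟩
    1 * (1 * count M 1 + 1)              ≡⟨ cong (1 *_) (+-comm _ 1) ⟩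
    1 * (1 + 1 * count M 1)              ≡⟨ cong (λ x → 1 * (1 + x)) (*-identityˡ (count M 1)) ⟩
    1 * (1 + count M 1)                  ≡⟨ cong (1 *_) (powerSum-step 0 M 0) ⟨
    1 * count (suc M) 1                  ∎
    where open ≡-Reasoning
  count-absorb zero    (suc D) = begin
    1 * count 1 (suc D)       ≡⟨ cong (1 *_) (powerSum-step 0 0 D) ⟩
    1 * (count 1 D + 1)       ≡⟨ *-distribˡ-+ 1 (count 1 D) 1 ⟩
    1 * count 1 D + 1         ≡⟨ cong (_+ 1) (count-absorb zero D) ⟩
    suc D * 1 + 1             ≡⟨ solve 1 (λ D → (con 1 :+ D) :* con 1 :+ con 1 := (con 2 :+ D) :* con 1) refl D ⟩
    (2 + D) * 1               ∎
    where open ≡-Reasoning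
  count-absorb (suc M) (suc D) = begin
    (2 + M) * count (2 + M) (suc D)                     ≡⟨ cong ((2 + M) *_) (powerSum-step 0 (suc M) D) ⟩
    (2 + M) * (count (2 + M) D + x)                     ≡⟨ *-distribˡ-+ (2 + M) (count (2 + M) D) x ⟩
    (2 + M) * count (2 + M) D + (2 + M) * x             ≡⟨ cong (_+ (2 + M) * x) (count-absorb (suc M) D) ⟩
    suc D * x + (2 + M) * x                             ≡⟨ solve 3 (λ D M x → (con 1 :+ D) :* x :+ (con 2 :+ M) :* x := (con 2 :+ D) :* x :+ (con 1 :+ M) :* x) refl D M x ⟩
    (2 + D) * x + suc M * x                             ≡⟨ cong ((2 + D) * x +_) (count-absorb M (suc D)) ⟩
    (2 + D) * x + (2 + D) * count M (2 + D)             ≡⟨ *-distribˡ-+ (2 + D) x _ ⟨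
    (2 + D) * (x + count M (2 + D))                     ≡⟨ cong ((2 + D) *_) (powerSum-step 0 M (suc D)) ⟨
    (2 + D) * count (suc M) (2 + D)                     ∎
    where
    open ≡-Reasoning
    x = count (suc M) (suc D)

  count-suc : ∀ M D → suc M * count (suc M) D ≡ (D + suc M) * count M D
  count-suc M zero    = cong (suc M *_) (trans (powerSum-zero 0 (suc M)) (sym (powerSum-zero 0 M)))
  count-suc M (suc D) = begin
    suc M * count (suc M) (suc D)          ≡⟨ cong (suc M *_) (powerSum-step 0 M D) ⟩
    suc M * (count (suc M) D + y)          ≡⟨ *-distribˡ-+ (suc M) (count (suc M) D) y ⟩
    suc M * count (suc M) D + suc M * y    ≡⟨ cong (_+ suc M * y) (count-absorb M D) ⟩
    suc D * y + suc M * y                  ≡⟨ *-distribʳ-+ y (suc D) (suc M) ⟨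
    (suc D + suc M) * y                    ∎
    where
    open ≡-Reasoning
    y = count M (suc D)

  private
    shift : ∀ D M j → D + M + suc j ≡ D + suc M + j
    shift = solve 3 (λ D M j → D :+ M :+ (con 1 :+ j) := D :+ (con 1 :+ M) :+ j) refl

    swap : ∀ B b j x → B * b * (suc j * x) ≡ suc j * B * (b * x)
    swap = solve 4 (λ B b j x → B :* b :* ((con 1 :+ j) :* x) := (con 1 :+ j) :* B :* (b :* x)) refl

    regroup : ∀ j f m a c → suc j * m * (f * a * c) ≡ suc j * f * a * (m * c)
    regroup = solve 5 (λ j f m a c → (con 1 :+ j) :* m :* (f :* a :* c) := (con 1 :+ j) :* f :* a :* (m :* c)) refl

    reorder : ∀ j f e a d → suc j * f * (e * a) * d ≡ suc j * f * a * (e * d)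
    reorder = solve 5 (λ j f e a d → (con 1 :+ j) :* f :* (e :* a) :* d := (con 1 :+ j) :* f :* a :* (e :* d)) refl

  -- Each step trades one power of z for one more summation, by `powerSum-parts-≤`. By `count-suc`
  -- the extra summation multiplies the count by (D + M + 1) / (M + 1), which the hypotheses bound
  -- by A / B. Since `M` grows along the induction, `A` has to dominate D + M + j.
  moment-≤ : ∀ {A B} j M D → B ≤ suc M → D + M + j ≤ A → B ^ j * powerSum j M D ≤ j ! * A ^ j * count M D
  moment-≤ zero    M D B≤ ≤A = ≤-refl
  moment-≤ {A} {B} (suc j) M D B≤ ≤A = begin
    B * b * powerSum (suc j) M D                          ≤⟨ *-monoʳ-≤ (B * b) (powerSum-parts-≤ j M D) ⟩
    B * b * (suc j * x)                            ≡⟨ swap B b j x ⟩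
    suc j * B * (b * x)                            ≤⟨ *-monoʳ-≤ (suc j * B) (moment-≤ j (suc M) D (m≤n⇒m≤1+n B≤) (subst (_≤ A) (shift D M j) ≤A)) ⟩
    suc j * B * (f * a * c)                        ≤⟨ *-monoˡ-≤ (f * a * c) (*-monoʳ-≤ (suc j) B≤) ⟩
    suc j * suc M * (f * a * c)                    ≡⟨ regroup j f (suc M) a c ⟩
    suc j * f * a * (suc M * c)                    ≡⟨ cong (suc j * f * a *_) (count-suc M D) ⟩
    suc j * f * a * ((D + suc M) * count M D)      ≤⟨ *-monoʳ-≤ (suc j * f * a) (*-monoˡ-≤ (count M D) D+M<A) ⟩
    suc j * f * a * (A * count M D)                ≡⟨ sym (reorder j f A a d) ⟩
    suc j * f * (A * a) * count M D                ∎
    where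
    open ≤-Reasoning
    b = B ^ j
    a = A ^ j
    f = j !
    x = powerSum j (suc M) D
    c = count (suc M) D
    d = count M D
    D+M<A : D + suc M ≤ A
    D+M<A = ≤-trans (≤-trans (m≤m+n (D + suc M) j) (≤-reflexive (sym (shift D M j)))) ≤A

  -- The same trade, except that `powerSum-parts-≥` also lowers the range by one each time. Hence
  -- the start at `D + j`, and the use of `count-absorb`, which relates counts at neighbouring
  -- ranges.
  moment-≥ : ∀ {A B} j M D → A ≤ suc D → M + j ≤ B → j ! * A ^ j * count M (D + j) ≤ B ^ j * powerSum j M (D + j)
  moment-≥ zero    M D A≤ ≤B = ≤-refl
  moment-≥ {A} {B} (suc j) M D A≤ ≤B rewrite +-suc D j = begin
    suc j * f * (A * a) * d                    ≤⟨ *-monoˡ-≤ d (*-monoʳ-≤ (suc j * f) (*-monoˡ-≤ a (≤-trans A≤ (s≤s (m≤m+n D j))))) ⟩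
    suc j * f * (suc (D + j) * a) * d          ≡⟨ reorder j f (suc (D + j)) a d ⟩
    suc j * f * a * (suc (D + j) * d)          ≡⟨ cong (suc j * f * a *_) (count-absorb M (D + j)) ⟨
    suc j * f * a * (suc M * c)                ≡⟨ sym (regroup j f (suc M) a c) ⟩
    suc j * suc M * (f * a * c)                ≤⟨ *-mono-≤ (*-monoʳ-≤ (suc j) M<B) (moment-≥ j (suc M) D A≤ (subst (_≤ B) (+-suc M j) ≤B)) ⟩
    suc j * B * (b * x)                        ≡⟨ sym (swap B b j x) ⟩
    B * b * (suc j * x)                        ≤⟨ *-monoʳ-≤ (B * b) (powerSum-parts-≥ j M (D + j)) ⟩
    B * b * powerSum (suc j) M (suc (D + j))          ∎
    where
    open ≤-Reasoning
    b = B ^ j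
    a = A ^ j
    f = j !
    x = powerSum j (suc M) (D + j)
    c = count (suc M) (D + j)
    d = count M (suc (D + j))
    M<B : suc M ≤ B
    M<B = ≤-trans (≤-trans (s≤s (m≤m+n M j)) (≤-reflexive (sym (+-suc M j)))) ≤B

  ^-distribʳ-* : ∀ m n o → (m * n) ^ o ≡ m ^ o * n ^ o
  ^-distribʳ-* m n zero    = refl
  ^-distribʳ-* m n (suc o) = trans (cong (m * n *_) (^-distribʳ-* m n o))
    (solve 4 (λ m n x y → m :* n :* (x :* y) := m :* x :* (n :* y)) refl m n (m ^ o) (n ^ o))

  count≥1 : ∀ M D → 1 ≤ count M D
  count≥1 zero    D       = ≤-refl
  count≥1 (suc M) zero    = ≤-refl
  count≥1 (suc M) (suc D) = ≤-trans (count≥1 M (suc D))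
    (≤-trans (m≤n+m _ (count (suc M) D)) (≤-reflexive (sym (powerSum-step 0 M D))))

  private
    -- With M = r T, the quotients are (T M + r + M + r) / (T M) = 1 + 1/T + 2/T² and (M + r) / M =
    -- 1 + 1/T. Their product is at most 1 + 4/T = (t + 1) / t as T ≥ 4. The cubic in `s` is the
    -- exact slack.
    parameter-bound : ∀ r s → let t = suc s; T = 4 * t; M = r * T in
      t * (T * M + r + M + r) * (M + r) ≤ suc t * M * (T * M)
    parameter-bound r s = ≤-trans (m≤m+n _ (r * r * (32 * (s * s * s) + 84 * (s * s) + 70 * s + 18)))
      (≤-reflexive (solve 2 (λ r s → let t = con 1 :+ s; T = con 4 :* t; M = r :* T in
        t :* (T :* M :+ r :+ M :+ r) :* (M :+ r) :+ r :* r :* (con 32 :* (s :* s :* s) :+ con 84 :* (s :* s) :+ con 70 :* s :+ con 18)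
          := (con 1 :+ t) :* M :* (T :* M)) refl r s))

  -- An exponential variable of mean A / B has moments j! (A / B)^j.
  approximateExponential : ∀ r t → 1 ≤ r → 1 ≤ t →
    ∃[ Z ] ∃[ A ] ∃[ B ] 1 ≤ length Z × 1 ≤ A × 1 ≤ B × (∀ j → j ≤ r →
      B ^ j * moment Z j ≤ j ! * A ^ j * length Z ×
      (t * A) ^ j * (j ! * length Z) ≤ (suc t * B) ^ j * moment Z j)
  approximateExponential r@(suc _) t@(suc s) _ _ =
    points M D , A , M , subst (1 ≤_) (moment-0 (points M D)) (count≥1 M D) ,
    ≤-trans (m≤m+n 1 _) (m≤n+m r (D + M)) , s≤s z≤n ,
    λ j j≤r → upper j j≤r , lower j j≤r
    where
    T = 4 * t
    M = r * T
    -- The extra `r` lets `D` be split as D′ + j with D′ ≥ T M for every j ≤ r, as `moment-≥`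
    -- demands.
    D = T * M + r
    A = D + M + r
    moment-0 : ∀ Z → moment Z 0 ≡ length Z
    moment-0 []      = refl
    moment-0 (z ∷ Z) = cong suc (moment-0 Z)
    upper : ∀ j → j ≤ r → M ^ j * powerSum j M D ≤ j ! * A ^ j * length (points M D)
    upper j j≤r = subst (λ c → M ^ j * powerSum j M D ≤ j ! * A ^ j * c) (moment-0 (points M D))
      (moment-≤ j M D (n≤1+n M) (+-monoʳ-≤ (D + M) j≤r))
    lower : ∀ j → j ≤ r → (t * A) ^ j * (j ! * length (points M D)) ≤ (suc t * M) ^ j * powerSum j M D
    -- `moment-≥` gives the estimate with mean T M / (M + r). Replacing this mean by A / M costs a
    -- factor (t + 1) / t per power, by `parameter-bound`.
    lower j j≤r = *-cancelˡ-≤ ((M + r) ^ j) {{m^n≢0 (M + r) j}} (begin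
      (M + r) ^ j * ((t * A) ^ j * (j ! * c))     ≡⟨ *-assoc ((M + r) ^ j) _ _ ⟨
      (M + r) ^ j * (t * A) ^ j * (j ! * c)       ≡⟨ cong (_* (j ! * c)) (trans (*-comm _ ((t * A) ^ j)) (sym (^-distribʳ-* (t * A) (M + r) j))) ⟩
      (t * A * (M + r)) ^ j * (j ! * c)           ≤⟨ *-monoˡ-≤ (j ! * c) (^-monoˡ-≤ j (parameter-bound r s)) ⟩
      (suc t * M * (T * M)) ^ j * (j ! * c)       ≡⟨ cong (_* (j ! * c)) (^-distribʳ-* (suc t * M) (T * M) j) ⟩
      (suc t * M) ^ j * (T * M) ^ j * (j ! * c)   ≡⟨ solve 4 (λ a b c d → a :* b :* (c :* d) := a :* (c :* b :* d)) refl ((suc t * M) ^ j) ((T * M) ^ j) (j !) c ⟩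
      (suc t * M) ^ j * (j ! * (T * M) ^ j * c)   ≤⟨ *-monoʳ-≤ ((suc t * M) ^ j) core ⟩
      (suc t * M) ^ j * ((M + r) ^ j * powerSum j M D)   ≡⟨ solve 3 (λ a b c → a :* (b :* c) := b :* (a :* c)) refl ((suc t * M) ^ j) ((M + r) ^ j) (powerSum j M D) ⟩
      (M + r) ^ j * ((suc t * M) ^ j * powerSum j M D)   ∎)
      where
      open ≤-Reasoning
      c = length (points M D)
      D≡ : T * M + (r ∸ j) + j ≡ D
      D≡ = trans (+-assoc (T * M) (r ∸ j) j) (cong (T * M +_) (m∸n+n≡m j≤r))
      core : j ! * (T * M) ^ j * c ≤ (M + r) ^ j * powerSum j M D
      core = subst₂ (λ D c → j ! * (T * M) ^ j * c ≤ (M + r) ^ j * powerSum j M D) D≡ (trans (cong (count M) D≡) (moment-0 (points M D)))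
        (moment-≥ j M (T * M + (r ∸ j)) (≤-trans (m≤m+n (T * M) _) (n≤1+n _)) (+-monoʳ-≤ M j≤r))

  -- Finite sums and products, and averages over tuples.

  ∑-mono : ∀ {m} {f g : Vector ℕ m} → (∀ s → f s ≤ g s) → ∑ f ≤ ∑ g
  ∑-mono {zero}  f≤g = ≤-refl
  ∑-mono {suc m} f≤g = +-mono-≤ (f≤g zero) (∑-mono (f≤g ∘ suc))

  ∏-mono : ∀ {m} {f g : Vector ℕ m} → (∀ s → f s ≤ g s) → ∏ f ≤ ∏ g
  ∏-mono {zero}  f≤g = ≤-refl
  ∏-mono {suc m} f≤g = *-mono-≤ (f≤g zero) (∏-mono (f≤g ∘ suc))

  f≤∑f : ∀ {m} (f : Vector ℕ m) s → f s ≤ ∑ f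
  f≤∑f f zero    = m≤m+n _ _
  f≤∑f f (suc s) = ≤-trans (f≤∑f (f ∘ suc) s) (m≤n+m _ _)

  ∑-const : ∀ m x → ∑ {m} (λ _ → x) ≡ m * x
  ∑-const zero    x = refl
  ∑-const (suc m) x = cong (x +_) (∑-const m x)

  ∏-const : ∀ m x → ∏ {m} (λ _ → x) ≡ x ^ m
  ∏-const zero    x = refl
  ∏-const (suc m) x = cong (x *_) (∏-const m x)

  ∏-^ : ∀ {m} x (b : Vector ℕ m) → ∏ (λ s → x ^ b s) ≡ x ^ ∑ b
  ∏-^ {zero}  x b = refl
  ∏-^ {suc m} x b = trans (cong (x ^ b zero *_) (∏-^ x (b ∘ suc))) (sym (^-distribˡ-+-* x (b zero) _))

  δ : ∀ {m} → Fin m → Fin m → ℕ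
  δ i j = if does (i ≟ᶠ j) then 1 else 0

  ∑-δ : ∀ {m} (c : Fin m) α → ∑ (λ s → δ c s * α) ≡ α
  ∑-δ {suc m} zero    α = trans (cong₂ _+_ (*-identityˡ α) (trans (∑-const m 0) (*-zeroʳ m))) (+-identityʳ α)
  ∑-δ {suc m} (suc c) α = ∑-δ c α

  ∏-δ : ∀ {m} (F : Fin m → ℕ → ℕ) → (∀ s → F s 0 ≡ 1) → ∀ c α → ∏ (λ s → F s (δ c s * α)) ≡ F c α
  ∏-δ {suc m} F F0 zero    α = trans (cong₂ _*_ (cong (F zero) (*-identityˡ α))
    (trans (∏-cong (F0 ∘ suc)) (trans (∏-const m 1) (^-zeroˡ m)))) (*-identityʳ (F zero α))
  ∏-δ {suc m} F F0 (suc c) α = trans (cong₂ _*_ (F0 zero) (∏-δ (F ∘ suc) (F0 ∘ suc) c α)) (*-identityˡ (F (suc c) α))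

  ∑ˡ-cong : ∀ {A : Set} {f g : A → ℕ} xs → f ≗ g → ∑ˡ xs f ≡ ∑ˡ xs g
  ∑ˡ-cong xs f≗g = cong sum (map-cong f≗g xs)

  ∑ˡ-*ˡ : ∀ {A : Set} k (xs : List A) f → ∑ˡ xs (λ x → k * f x) ≡ k * ∑ˡ xs f
  ∑ˡ-*ˡ k []       f = sym (*-zeroʳ k)
  ∑ˡ-*ˡ k (x ∷ xs) f = trans (cong (k * f x +_) (∑ˡ-*ˡ k xs f)) (sym (*-distribˡ-+ k (f x) _))

  ∑ˡ-*ʳ : ∀ {A : Set} k (xs : List A) f → ∑ˡ xs (λ x → f x * k) ≡ ∑ˡ xs f * k
  ∑ˡ-*ʳ k []       f = refl
  ∑ˡ-*ʳ k (x ∷ xs) f = trans (cong (f x * k +_) (∑ˡ-*ʳ k xs f)) (sym (*-distribʳ-+ k (f x) _))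

  ∑ˡ-product : ∀ {A B C : Set} (g : A → B → C) xs ys f →
               ∑ˡ (cartesianProductWith g xs ys) f ≡ ∑ˡ xs (λ x → ∑ˡ ys (λ y → f (g x y)))
  ∑ˡ-product g []       ys f = refl
  ∑ˡ-product g (x ∷ xs) ys f = trans (∑ˡ-++ (map (g x) ys) _ f)
    (cong₂ _+_ (cong sum (sym (map-∘ ys))) (∑ˡ-product g xs ys f))

  length-product : ∀ {A B C : Set} (g : A → B → C) xs ys → length (cartesianProductWith g xs ys) ≡ length xs * length ys
  length-product g []       ys = refl
  length-product g (x ∷ xs) ys = trans (length-++ (map (g x) ys)) (cong₂ _+_ (length-map (g x) ys) (length-product g xs ys))

  ∑ˡ-allFin : ∀ {m} (f : Fin m → ℕ) → ∑ˡ (allFin m) f ≡ ∑ f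
  ∑ˡ-allFin f = trans (cong sum (map-tabulate (λ i → i) f)) (sum-tabulate f)
    where
    sum-tabulate : ∀ {m} (f : Fin m → ℕ) → sum (tabulate f) ≡ ∑ f
    sum-tabulate {zero}  f = refl
    sum-tabulate {suc m} f = cong (f zero +_) (sum-tabulate (f ∘ suc))

  tuples : List ℕ → ∀ m → List (Vector ℕ m)
  tuples Z zero    = Vector.[] ∷ []
  tuples Z (suc m) = cartesianProductWith Vector._∷_ Z (tuples Z m)

  length-tuples : ∀ Z m → length (tuples Z m) ≡ length Z ^ m
  length-tuples Z zero    = refl
  length-tuples Z (suc m) = trans (length-product Vector._∷_ Z (tuples Z m)) (cong (length Z *_) (length-tuples Z m))

  -- The coordinates of a uniformly chosen tuple are independent, so mixed moments factor.
  ∑-tuples : ∀ Z {m} (b : Vector ℕ m) → ∑ˡ (tuples Z m) (λ t → ∏ (λ s → t s ^ b s)) ≡ ∏ (λ s → moment Z (b s))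
  ∑-tuples Z {zero}  b = refl
  ∑-tuples Z {suc m} b = begin
    ∑ˡ (tuples Z (suc m)) (λ t → ∏ (λ s → t s ^ b s))
      ≡⟨ ∑ˡ-product Vector._∷_ Z (tuples Z m) _ ⟩
    ∑ˡ Z (λ z → ∑ˡ (tuples Z m) (λ t → z ^ b zero * ∏ (λ s → t s ^ b (suc s))))
      ≡⟨ ∑ˡ-cong Z (λ z → trans (∑ˡ-*ˡ (z ^ b zero) (tuples Z m) _) (cong (z ^ b zero *_) (∑-tuples Z (b ∘ suc)))) ⟩
    ∑ˡ Z (λ z → z ^ b zero * ∏ (λ s → moment Z (b (suc s))))
      ≡⟨ ∑ˡ-*ʳ _ Z (_^ b zero) ⟩
    moment Z (b zero) * ∏ (λ s → moment Z (b (suc s))) ∎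
    where open ≡-Reasoning


  -- Exponents collected by letter, and collisions.

  power : Vector ℕ n → Vec ℕ n → ℕ
  power z a = ∏ (λ j → z j ^ lookup a j)

  -- The vector b of the overview at one fixed position, where `c j` is the letter of the j-th word
  -- there.
  load : Vector (Fin m) n → Vec ℕ n → Vector ℕ m
  load c []      s = 0
  load c (α ∷ a) s = δ (c zero) s * α + load (c ∘ suc) a s

  ∑-load : (c : Vector (Fin m) n) (a : Vec ℕ n) → ∑ (load c a) ≡ Vec.sum a
  ∑-load {m} c []      = trans (∑-const m 0) (*-zeroʳ m)
  ∑-load {m} c (α ∷ a) = trans (∑-distrib-+ (λ s → δ (c zero) s * α) (load (c ∘ suc) a))
    (cong₂ _+_ (∑-δ (c zero) α) (∑-load (c ∘ suc) a))

  power-load : (t : Vector ℕ m) (c : Vector (Fin m) n) (a : Vec ℕ n) →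
               power (t ∘ c) a ≡ ∏ (λ s → t s ^ load c a s)
  power-load {m} t c []      = sym (trans (∏-const m 1) (^-zeroˡ m))
  power-load {m} t c (α ∷ a) = begin
    t (c zero) ^ α * power (t ∘ c ∘ suc) a
      ≡⟨ cong₂ _*_ (sym (∏-δ (λ s → t s ^_) (λ _ → refl) (c zero) α)) (power-load t (c ∘ suc) a) ⟩
    ∏ (λ s → t s ^ (δ (c zero) s * α)) * ∏ (λ s → t s ^ load (c ∘ suc) a s)
      ≡⟨ ∏-distrib-* (λ s → t s ^ (δ (c zero) s * α)) _ ⟨
    ∏ (λ s → t s ^ (δ (c zero) s * α) * t s ^ load (c ∘ suc) a s)
      ≡⟨ ∏-cong (λ s → sym (^-distribˡ-+-* (t s) (δ (c zero) s * α) _)) ⟩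
    ∏ (λ s → t s ^ load c (α ∷ a) s) ∎
    where open ≡-Reasoning

  infix 9 _!!
  _!! : Vec ℕ n → ℕ
  []      !! = 1
  (α ∷ a) !! = α ! * a !!

  m!n!≤[m+n]! : ∀ m n → m ! * n ! ≤ (m + n) !
  m!n!≤[m+n]! zero    n = ≤-reflexive (*-identityˡ (n !))
  m!n!≤[m+n]! (suc m) n = ≤-trans (≤-reflexive (*-assoc (suc m) (m !) (n !)))
    (*-mono-≤ (m≤m+n (suc m) n) (m!n!≤[m+n]! m n))

  ∏!≤∑! : (b : Vector ℕ m) → ∏ (λ s → b s !) ≤ (∑ b) !
  ∏!≤∑! {zero}  b = ≤-refl
  ∏!≤∑! {suc m} b = ≤-trans (*-monoʳ-≤ (b zero !) (∏!≤∑! (b ∘ suc))) (m!n!≤[m+n]! (b zero) _)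

  -- Merging exponents only increases a product of factorials, so collisions never harm the lower
  -- bound.
  !!≤∏load! : (c : Vector (Fin m) n) (a : Vec ℕ n) → a !! ≤ ∏ (λ s → load c a s !)
  !!≤∏load! {m} c []      = ≤-reflexive (sym (trans (∏-const m 1) (^-zeroˡ m)))
  !!≤∏load! {m} c (α ∷ a) = begin
    α ! * a !!                                       ≤⟨ *-monoʳ-≤ (α !) (!!≤∏load! (c ∘ suc) a) ⟩
    α ! * ∏ (λ s → l s !)                            ≡⟨ cong (_* ∏ (λ s → l s !)) (∏-δ (λ _ → _!) (λ _ → refl) (c zero) α) ⟨
    ∏ (λ s → d s !) * ∏ (λ s → l s !)                ≡⟨ ∏-distrib-* (λ s → d s !) _ ⟨
    ∏ (λ s → d s ! * l s !)                          ≤⟨ ∏-mono (λ s → m!n!≤[m+n]! (d s) (l s)) ⟩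
    ∏ (λ s → (d s + l s) !)                          ∎
    where
    open ≤-Reasoning
    d = λ s → δ (c zero) s * α
    l = load (c ∘ suc) a

  -- Σ_{j < j'} α_j α_{j'} [c_j = c_{j'}]
  collisions : Vector (Fin m) n → Vec ℕ n → ℕ
  collisions c []      = 0
  collisions c (α ∷ a) = α * load (c ∘ suc) a (c zero) + collisions (c ∘ suc) a

  private
    disjoint-! : ∀ m n → m * n ≡ 0 → (m + n) ! ≡ m ! * n !
    disjoint-! m n mn≡0 with m*n≡0⇒m≡0∨n≡0 m mn≡0
    ... | inj₁ refl = sym (*-identityˡ (n !))
    ... | inj₂ refl = trans (cong _! (+-identityʳ m)) (sym (*-identityʳ (m !)))

  no-collisions : (c : Vector (Fin m) n) (a : Vec ℕ n) → collisions c a ≡ 0 → ∏ (λ s → load c a s !) ≡ a !!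
  no-collisions {m} c []      _  = trans (∏-const m 1) (^-zeroˡ m)
  no-collisions {m} c (α ∷ a) eq = begin
    ∏ (λ s → (d s + l s) !)                ≡⟨ ∏-cong (λ s → disjoint-! (d s) (l s) (d*l s)) ⟩
    ∏ (λ s → d s ! * l s !)                ≡⟨ ∏-distrib-* (λ s → d s !) _ ⟩
    ∏ (λ s → d s !) * ∏ (λ s → l s !)      ≡⟨ cong₂ _*_ (∏-δ (λ _ → _!) (λ _ → refl) (c zero) α)
                                                (no-collisions (c ∘ suc) a (m+n≡0⇒n≡0 (α * l (c zero)) eq)) ⟩
    α ! * a !!                             ∎
    where
    open ≡-Reasoning
    d = λ s → δ (c zero) s * α
    l = load (c ∘ suc) a
    d*l : ∀ s → d s * l s ≡ 0
    d*l s with c zero ≟ᶠ s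
    ... | yes refl = trans (cong (_* l s) (*-identityˡ α)) (m+n≡0⇒m≡0 (α * l (c zero)) eq)
    ... | no  _    = refl

  -- Without collisions the two factorial products agree. With one, the collision count is at least
  -- 1 and already pays for the crude bound r!.
  ∏load!≤ : (c : Vector (Fin m) n) (a : Vec ℕ n) → ∏ (λ s → load c a s !) ≤ a !! + Vec.sum a ! * collisions c a
  ∏load!≤ c a with collisions c a in eq
  ... | zero  = ≤-trans (≤-reflexive (no-collisions c a eq)) (m≤m+n _ _)
  ... | suc k = ≤-trans (∏!≤∑! (load c a)) (≤-trans (≤-reflexive (cong _! (∑-load c a)))
    (≤-trans (m≤m*n (Vec.sum a !) (suc k)) (m≤n+m _ _)))

  -- Collisions averaged over the positions of a separated code.

  agree : Vector (Fin m) K → Vector (Fin m) K → ℕ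
  agree v w = ∑ (λ i → δ (v i) (w i))

  Separated : ℕ → Vector (Vector (Fin m) K) n → Set
  Separated {K = K} τ C = ∀ {i j} → i Fin.< j → τ * agree (C j) (C i) ≤ K

  ∑-load-at : ∀ τ (w : Vector (Fin m) K) (C : Vector (Vector (Fin m) K) n) (a : Vec ℕ n) →
              (∀ j → τ * agree (C j) w ≤ K) → τ * ∑ (λ i → load (λ j → C j i) a (w i)) ≤ K * Vec.sum a
  ∑-load-at {K = K} τ w C [] h = ≤-reflexive (trans (cong (τ *_) (trans (∑-const K 0) (*-zeroʳ K))) (trans (*-zeroʳ τ) (sym (*-zeroʳ K))))
  ∑-load-at {K = K} τ w C (α ∷ a) h = begin
    τ * ∑ (λ i → δ (C zero i) (w i) * α + l i)          ≡⟨ cong (τ *_) (∑-distrib-+ (λ i → δ (C zero i) (w i) * α) l) ⟩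
    τ * (∑ (λ i → δ (C zero i) (w i) * α) + ∑ l)        ≡⟨ cong (λ x → τ * (x + ∑ l)) (*-distribʳ-sum α (λ i → δ (C zero i) (w i))) ⟨
    τ * (agree (C zero) w * α + ∑ l)                    ≡⟨ solve 4 (λ t x α l → t :* (x :* α :+ l) := t :* x :* α :+ t :* l) refl τ (agree (C zero) w) α (∑ l) ⟩
    τ * agree (C zero) w * α + τ * ∑ l                  ≤⟨ +-mono-≤ (*-monoˡ-≤ α (h zero)) (∑-load-at τ w (C ∘ suc) a (h ∘ suc)) ⟩
    K * α + K * Vec.sum a                               ≡⟨ *-distribˡ-+ K α _ ⟨
    K * (α + Vec.sum a)                                 ∎
    where
    open ≤-Reasoning
    l = λ i → load (λ j → C (suc j) i) a (w i)

  -- Summed over positions, a pair j < j' contributes α_j α_j' times the agreement of the two words,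
  -- and the products α_j α_j' over such pairs sum to at most (Σ α_j)².
  ∑-collisions : ∀ τ (C : Vector (Vector (Fin m) K) n) (a : Vec ℕ n) → Separated τ C →
                 τ * ∑ (λ i → collisions (λ j → C j i) a) ≤ K * (Vec.sum a * Vec.sum a)
  ∑-collisions {K = K} τ C [] h = ≤-reflexive (trans (cong (τ *_) (trans (∑-const K 0) (*-zeroʳ K))) (trans (*-zeroʳ τ) (sym (*-zeroʳ K))))
  ∑-collisions {K = K} τ C (α ∷ a) h = begin
    τ * ∑ (λ i → α * l i + k i)              ≡⟨ cong (τ *_) (∑-distrib-+ (λ i → α * l i) k) ⟩
    τ * (∑ (λ i → α * l i) + ∑ k)            ≡⟨ cong (λ x → τ * (x + ∑ k)) (*-distribˡ-sum α l) ⟨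
    τ * (α * ∑ l + ∑ k)                      ≡⟨ solve 4 (λ t α l k → t :* (α :* l :+ k) := α :* (t :* l) :+ t :* k) refl τ α (∑ l) (∑ k) ⟩
    α * (τ * ∑ l) + τ * ∑ k                  ≤⟨ +-mono-≤ (*-monoʳ-≤ α (∑-load-at τ (C zero) (C ∘ suc) a (λ j → h (s≤s z≤n))))
                                                  (∑-collisions τ (C ∘ suc) a (λ i<j → h (s≤s i<j))) ⟩
    α * (K * x) + K * (x * x)                ≤⟨ m≤m+n _ (K * (α * α + α * x)) ⟩
    α * (K * x) + K * (x * x) + K * (α * α + α * x) ≡⟨ solve 3 (λ α K x → α :* (K :* x) :+ K :* (x :* x) :+ K :* (α :* α :+ α :* x)
                                                                       := K :* ((α :+ x) :* (α :+ x))) refl α K x ⟩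
    K * ((α + x) * (α + x))                  ∎
    where
    open ≤-Reasoning
    x = Vec.sum a
    l = λ i → load (λ j → C (suc j) i) a (C zero i)
    k = λ i → collisions (λ j → C (suc j) i) a

  -- Greedy construction of a separated code.

  below-average : (f : Vector ℕ (suc m)) → ∃[ s ] suc m * f s ≤ ∑ f
  below-average {zero}  f = zero , ≤-refl
  below-average {suc m} f with below-average (f ∘ suc)
  ... | s , h with ≤-total (f zero) (f (suc s))
  ... | inj₁ f0≤ = zero  , +-monoʳ-≤ (f zero) (≤-trans (*-monoʳ-≤ (suc m) f0≤) h)
  ... | inj₂ ≤f0 = suc s , +-mono-≤ ≤f0 h

  ∑-^δ : ∀ x (c : Fin m) → suc (∑ (λ s → x ^ δ c s)) ≡ m + x
  ∑-^δ {suc m} x zero = trans (cong suc (cong₂ _+_ (*-identityʳ x) (trans (∑-const m 1) (*-identityʳ m)))) (cong suc (+-comm x m))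
  ∑-^δ {suc m} x (suc c) = cong suc (∑-^δ x c)

  -- Method of conditional expectations: each letter of w is chosen so that the
  -- weighted sum at most doubles.
  greedy : ∀ {m K n} (C : Vector (Vector (Fin (suc m)) K) n) (ω : Vector ℕ n) →
           ∃[ w ] ∑ (λ j → ω j * (2 + m) ^ agree (C j) w) ≤ 2 ^ K * ∑ ω
  greedy {m} {zero} C ω = Vector.[] , ≤-reflexive (trans (∑-cong (λ j → *-identityʳ (ω j))) (sym (*-identityˡ (∑ ω))))
  greedy {m} {suc K} {n} C ω = s Vector.∷ w , (begin
    ∑ (λ j → ω j * (2 + m) ^ (δ (C j zero) s + agree (C j ∘ suc) w))
      ≡⟨ ∑-cong (λ j → trans (cong (ω j *_) (^-distribˡ-+-* (2 + m) (δ (C j zero) s) _)) (sym (*-assoc (ω j) _ _))) ⟩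
    ∑ (λ j → ω′ s j * (2 + m) ^ agree (C j ∘ suc) w)     ≤⟨ rest ⟩
    2 ^ K * ∑ (ω′ s)                                    ≤⟨ *-monoʳ-≤ (2 ^ K) halved ⟩
    2 ^ K * (2 * ∑ ω)                                   ≡⟨ solve 2 (λ x y → x :* (con 2 :* y) := con 2 :* x :* y) refl (2 ^ K) (∑ ω) ⟩
    2 ^ suc K * ∑ ω                                     ∎)
    where
    open ≤-Reasoning
    ω′ : Fin (suc m) → Vector ℕ n
    ω′ s j = ω j * (2 + m) ^ δ (C j zero) s
    choice = below-average (λ s → ∑ (ω′ s))
    s = proj₁ choice
    -- This fixes the base `2 + m`: averaged over the `suc m` letters, a weight grows by (m + (2 +
    -- m)) / (m + 1), which is exactly 2.
    total : ∑ (λ s → ∑ (ω′ s)) ≡ suc m * (2 * ∑ ω)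
    total = begin-equality
      ∑ (λ s → ∑ (ω′ s))                                  ≡⟨ ∑-comm ω′ ⟩
      ∑ (λ j → ∑ (λ s → ω j * (2 + m) ^ δ (C j zero) s))  ≡⟨ ∑-cong (λ j → sym (*-distribˡ-sum (ω j) (λ s → (2 + m) ^ δ (C j zero) s))) ⟩
      ∑ (λ j → ω j * ∑ (λ s → (2 + m) ^ δ (C j zero) s))  ≡⟨ ∑-cong (λ j → cong (ω j *_) (suc-injective (∑-^δ (2 + m) (C j zero)))) ⟩
      ∑ (λ j → ω j * (m + (2 + m)))                       ≡⟨ *-distribʳ-sum (m + (2 + m)) ω ⟨
      ∑ ω * (m + (2 + m))                                 ≡⟨ solve 2 (λ x m → x :* (m :+ (con 2 :+ m)) := (con 1 :+ m) :* (con 2 :* x)) refl (∑ ω) m ⟩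
      suc m * (2 * ∑ ω)                                   ∎
    halved : ∑ (ω′ s) ≤ 2 * ∑ ω
    halved = *-cancelˡ-≤ (suc m) (≤-trans (proj₂ choice) (≤-reflexive total))
    tail = greedy (λ j → C j ∘ suc) (ω′ s)
    w = proj₁ tail
    rest = proj₂ tail

  ^-cancelʳ-≤ : ∀ b → 1 < b → ∀ {m n} → b ^ m ≤ b ^ n → m ≤ n
  ^-cancelʳ-≤ b 1<b {m} {n} h with ≤-total m n
  ... | inj₁ m≤n = m≤n
  ... | inj₂ n≤m with m≤n⇒m<n∨m≡n n≤m
  ...   | inj₁ n<m  = contradiction (^-monoʳ-< b 1<b n<m) (≤⇒≯ h)
  ...   | inj₂ refl = ≤-refl

  -- Words are added one at a time. Starting `greedy` with unit weights, an agreement g with an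
  -- earlier word satisfies (4^τ)^g ≤ 2^K n ≤ 4^K, hence τ g ≤ K. This determines the alphabet size
  -- 4^τ - 1.
  separatedCode : ∀ τ {m} → 2 + m ≡ 4 ^ τ → ∀ K n → n ≤ 2 ^ K → ∃[ C ] Separated {suc m} {K} {n} τ C
  separatedCode τ eq K zero    n≤ = (λ ()) , λ {i} → λ { {()} }
  separatedCode τ {m} eq K (suc n) n<
    with separatedCode τ {m} eq K n (<⇒≤ n<)
  ... | C , sep with greedy C (λ _ → 1)
  ... | w , h = w Vector.∷ C , λ {i} {j} → separated i j
    where
    open ≤-Reasoning
    far : ∀ j → τ * agree (C j) w ≤ K
    far j = ^-cancelʳ-≤ 4 (s≤s (s≤s z≤n)) (begin
      4 ^ (τ * agree (C j) w)                    ≡⟨ ^-*-assoc 4 τ _ ⟨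
      (4 ^ τ) ^ agree (C j) w                    ≡⟨ cong (_^ agree (C j) w) eq ⟨
      (2 + m) ^ agree (C j) w                    ≡⟨ *-identityˡ _ ⟨
      1 * (2 + m) ^ agree (C j) w                ≤⟨ f≤∑f (λ j → 1 * (2 + m) ^ agree (C j) w) j ⟩
      ∑ (λ j → 1 * (2 + m) ^ agree (C j) w)      ≤⟨ h ⟩
      2 ^ K * ∑ {n} (λ _ → 1)                    ≡⟨ cong (2 ^ K *_) (trans (∑-const n 1) (*-identityʳ n)) ⟩
      2 ^ K * n                                  ≤⟨ *-monoʳ-≤ (2 ^ K) (<⇒≤ n<) ⟩
      2 ^ K * 2 ^ K                              ≡⟨ ^-distribʳ-* 2 2 K ⟨
      4 ^ K                                      ∎)
    separated : ∀ i j → i Fin.< j → τ * agree ((w Vector.∷ C) j) ((w Vector.∷ C) i) ≤ K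
    separated zero    (suc j) _         = far j
    separated (suc i) (suc j) (s≤s i<j) = sep i<j

  -- Multinomial coefficients and integer roots.

  multinomial : Vec ℕ n → ℕ
  multinomial []      = 1
  multinomial (α ∷ a) = ((α + Vec.sum a) choose α) * multinomial a

  choose-!! : ∀ i j → ((i + j) choose i) * (i ! * j !) ≡ (i + j) !
  choose-!! i j = begin
    ((i + j) choose i) * (i ! * j !)                ≡⟨ cong (λ k → ((i + j) choose i) * (i ! * k !)) (m+n∸m≡n i j) ⟨
    ((i + j) choose i) * (i ! * (i + j ∸ i) !)      ≡⟨ cong (_* (i ! * (i + j ∸ i) !)) (nCk≡n!/k![n-k]! (m≤m+n i j)) ⟩
    ((i + j) ! / (i ! * (i + j ∸ i) !)) * (i ! * (i + j ∸ i) !) ≡⟨ m/n*n≡m (k![n∸k]!∣n! (m≤m+n i j)) ⟩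
    (i + j) ! ∎
    where
    open ≡-Reasoning
    instance _ = i !* (i + j ∸ i) !≢0

  multinomial-!! : (a : Vec ℕ n) → multinomial a * a !! ≡ Vec.sum a !
  multinomial-!! []      = refl
  multinomial-!! (α ∷ a) = begin
    (c * multinomial a) * (α ! * a !!)    ≡⟨ solve 4 (λ c k f g → c :* k :* (f :* g) := c :* (f :* (k :* g))) refl c (multinomial a) (α !) (a !!) ⟩
    c * (α ! * (multinomial a * a !!))    ≡⟨ cong (λ x → c * (α ! * x)) (multinomial-!! a) ⟩
    c * (α ! * Vec.sum a !)               ≡⟨ choose-!! α (Vec.sum a) ⟩
    (α + Vec.sum a) !                     ∎
    where
    open ≡-Reasoning
    c = (α + Vec.sum a) choose α

  -- This q is the r-th root of `L` rounded up. It increases only when `L` passes q^r, and then q +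
  -- 1 ≤ 2 q keeps the overshoot below the constant factor 2^r.
  root : ∀ r → 1 ≤ r → ∀ L → 1 ≤ L → ∃[ q ] 1 ≤ q × L ≤ q ^ r × q ^ r ≤ 2 ^ r * L
  root r 1≤r (suc zero) _ = 1 , ≤-refl , ≤-reflexive (sym (^-zeroˡ r)) ,
    ≤-trans (≤-reflexive (^-zeroˡ r)) (≤-trans (m^n>0 2 r) (m≤m*n (2 ^ r) 1))
  root r@(suc _) 1≤r (suc L@(suc _)) _ with root r 1≤r L (s≤s z≤n)
  ... | q , 1≤q , L≤ , ≤L with m≤n⇒m<n∨m≡n L≤
  ...   | inj₁ L< = q , 1≤q , L< , ≤-trans ≤L (*-monoʳ-≤ (2 ^ r) (n≤1+n L))
  ...   | inj₂ L≡ = suc q , s≤s z≤n , ≤-trans (s≤s L≤) (^-monoˡ-< r (n<1+n q)) , (begin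
    suc q ^ r          ≤⟨ ^-monoˡ-≤ r (≤-trans (+-monoˡ-≤ q 1≤q) (≤-reflexive (cong (q +_) (sym (+-identityʳ q))))) ⟩
    (2 * q) ^ r        ≡⟨ ^-distribʳ-* 2 q r ⟩
    2 ^ r * q ^ r      ≡⟨ cong (2 ^ r *_) L≡ ⟨
    2 ^ r * L          ≤⟨ *-monoʳ-≤ (2 ^ r) (n≤1+n L) ⟩
    2 ^ r * suc L      ∎)
    where open ≤-Reasoning

  !!≥1 : (a : Vec ℕ n) → 1 ≤ a !!
  !!≥1 []      = ≤-refl
  !!≥1 (α ∷ a) = *-mono-≤ (1≤n! α) (!!≥1 a)

  -- Bounds on the coefficients of the sum of powers.

  ∑∏load!≥ : (C : Vector (Vector (Fin m) K) n) (a : Vec ℕ n) →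
             K * a !! ≤ ∑ (λ i → ∏ (λ s → load (λ j → C j i) a s !))
  ∑∏load!≥ {K = K} C a = ≤-trans (≤-reflexive (sym (∑-const K (a !!)))) (∑-mono (λ i → !!≤∏load! (λ j → C j i) a))

  -- The origin of the separation t r! r²: there are at most K r² / (t r! r²) collisions in total,
  -- each costing at most r!, so the excess is at most K / t, a 1/t fraction of the main term since
  -- a! ≥ 1.
  ∑∏load!≤ : ∀ r t → 1 ≤ r → (C : Vector (Vector (Fin m) K) n) → Separated (t * (r ! * (r * r))) C →
             (a : Vec ℕ n) → Vec.sum a ≡ r →
             t * ∑ (λ i → ∏ (λ s → load (λ j → C j i) a s !)) ≤ suc t * (K * a !!)
  ∑∏load!≤ {K = K} r t 1≤r C sep a refl = begin
    t * ∑ (λ i → ∏ (λ s → load (λ j → C j i) a s !))  ≤⟨ *-monoʳ-≤ t (∑-mono (λ i → ∏load!≤ (λ j → C j i) a)) ⟩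
    t * ∑ (λ i → a !! + r ! * k i)                    ≡⟨ cong (t *_) (∑-distrib-+ {K} (λ _ → a !!) (λ i → r ! * k i)) ⟩
    t * (∑ {K} (λ _ → a !!) + ∑ (λ i → r ! * k i))    ≡⟨ cong₂ (λ x y → t * (x + y)) (∑-const K (a !!)) (sym (*-distribˡ-sum (r !) k)) ⟩
    t * (K * a !! + r ! * ∑ k)                        ≡⟨ *-distribˡ-+ t (K * a !!) _ ⟩
    t * (K * a !!) + t * (r ! * ∑ k)                  ≤⟨ +-monoʳ-≤ (t * (K * a !!)) few ⟩
    t * (K * a !!) + K                                ≤⟨ +-monoʳ-≤ (t * (K * a !!)) (m≤m*n K (a !!) {{>-nonZero (!!≥1 a)}}) ⟩
    t * (K * a !!) + K * a !!                         ≡⟨ +-comm (t * (K * a !!)) _ ⟩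
    suc t * (K * a !!)                                ∎
    where
    open ≤-Reasoning
    k = λ i → collisions (λ j → C j i) a
    few : t * (r ! * ∑ k) ≤ K
    few = *-cancelˡ-≤ (r * r) {{>-nonZero (*-mono-≤ 1≤r 1≤r)}} (begin
      r * r * (t * (r ! * ∑ k))      ≡⟨ solve 4 (λ s t f k → s :* (t :* (f :* k)) := t :* (f :* s) :* k) refl (r * r) t (r !) (∑ k) ⟩
      t * (r ! * (r * r)) * ∑ k      ≤⟨ ∑-collisions (t * (r ! * (r * r))) C a sep ⟩
      K * (r * r)                    ≡⟨ *-comm K (r * r) ⟩
      r * r * K                      ∎)

  -- The entries of `b` sum to `r`, so the powers of A / B multiply to (A / B)^r whatever the load.
  -- Only the factorials remember how the exponents were distributed.
  ∏-moment-≤ : ∀ {r A B} Z → (∀ j → j ≤ r → B ^ j * moment Z j ≤ j ! * A ^ j * length Z) →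
               (b : Vector ℕ m) → ∑ b ≡ r →
               B ^ r * ∏ (λ s → moment Z (b s)) ≤ ∏ (λ s → b s !) * (A ^ r * length Z ^ m)
  ∏-moment-≤ {m} {r} {A} {B} Z bound b refl = begin
    B ^ r * ∏ (λ s → moment Z (b s))               ≡⟨ cong (_* ∏ (λ s → moment Z (b s))) (∏-^ B b) ⟨
    ∏ (λ s → B ^ b s) * ∏ (λ s → moment Z (b s))   ≡⟨ ∏-distrib-* (λ s → B ^ b s) _ ⟨
    ∏ (λ s → B ^ b s * moment Z (b s))             ≤⟨ ∏-mono (λ s → bound (b s) (f≤∑f b s)) ⟩
    ∏ (λ s → b s ! * A ^ b s * length Z)           ≡⟨ ∏-distrib-* (λ s → b s ! * A ^ b s) _ ⟩
    ∏ (λ s → b s ! * A ^ b s) * ∏ {m} (λ _ → length Z) ≡⟨ cong₂ _*_ (∏-distrib-* (λ s → b s !) _) (∏-const m (length Z)) ⟩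
    ∏ (λ s → b s !) * ∏ (λ s → A ^ b s) * length Z ^ m ≡⟨ cong (λ x → ∏ (λ s → b s !) * x * length Z ^ m) (∏-^ A b) ⟩
    ∏ (λ s → b s !) * A ^ r * length Z ^ m         ≡⟨ *-assoc (∏ (λ s → b s !)) _ _ ⟩
    ∏ (λ s → b s !) * (A ^ r * length Z ^ m)       ∎
    where open ≤-Reasoning

  ∏-moment-≥ : ∀ {r A B} Z → (∀ j → j ≤ r → A ^ j * (j ! * length Z) ≤ B ^ j * moment Z j) →
               (b : Vector ℕ m) → ∑ b ≡ r →
               A ^ r * (∏ (λ s → b s !) * length Z ^ m) ≤ B ^ r * ∏ (λ s → moment Z (b s))
  ∏-moment-≥ {m} {r} {A} {B} Z bound b refl = begin
    A ^ r * (∏ (λ s → b s !) * length Z ^ m)           ≡⟨ cong₂ (λ x y → x * (∏ (λ s → b s !) * y)) (∏-^ A b) (∏-const m (length Z)) ⟨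
    ∏ (λ s → A ^ b s) * (∏ (λ s → b s !) * ∏ {m} (λ _ → length Z)) ≡⟨ cong (∏ (λ s → A ^ b s) *_) (∏-distrib-* (λ s → b s !) _) ⟨
    ∏ (λ s → A ^ b s) * ∏ (λ s → b s ! * length Z)     ≡⟨ ∏-distrib-* (λ s → A ^ b s) _ ⟨
    ∏ (λ s → A ^ b s * (b s ! * length Z))             ≤⟨ ∏-mono (λ s → bound (b s) (f≤∑f b s)) ⟩
    ∏ (λ s → B ^ b s * moment Z (b s))                 ≡⟨ ∏-distrib-* (λ s → B ^ b s) _ ⟩
    ∏ (λ s → B ^ b s) * ∏ (λ s → moment Z (b s))       ≡⟨ cong (_* ∏ (λ s → moment Z (b s))) (∏-^ B b) ⟩
    B ^ r * ∏ (λ s → moment Z (b s))                   ∎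
    where open ≤-Reasoning

  -- For |a| = r this is the coefficient of x^a in Σ_z (Σ_j z_j x_j)^r, as `sumOfPowers` shows
  -- later.
  coefficient : List (Vector ℕ n) → Vec ℕ n → ℕ
  coefficient zs a = multinomial a * ∑ˡ zs (λ z → power z a)

  forms : List ℕ → Vector (Vector (Fin m) K) n → List (Vector ℕ n)
  forms {m} {K} Z C = cartesianProductWith (λ i t j → t (C j i)) (allFin K) (tuples Z m)

  length-forms : ∀ Z (C : Vector (Vector (Fin m) K) n) → length (forms Z C) ≡ K * length Z ^ m
  length-forms {m} {K} Z C = trans (length-product _ (allFin K) (tuples Z m)) (cong₂ _*_ (length-tabulate {n = K} (λ i → i)) (length-tuples Z m))

  ∑-forms : ∀ Z (C : Vector (Vector (Fin m) K) n) (a : Vec ℕ n) →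
            ∑ˡ (forms Z C) (λ z → power z a) ≡ ∑ (λ i → ∏ (λ s → moment Z (load (λ j → C j i) a s)))
  ∑-forms {m} {K} Z C a = begin
    ∑ˡ (forms Z C) (λ z → power z a)
      ≡⟨ ∑ˡ-product _ (allFin K) (tuples Z m) _ ⟩
    ∑ˡ (allFin K) (λ i → ∑ˡ (tuples Z m) (λ t → power (λ j → t (C j i)) a))
      ≡⟨ ∑ˡ-cong (allFin K) (λ i → trans (∑ˡ-cong (tuples Z m) (λ t → power-load t (λ j → C j i) a))
                                         (∑-tuples Z (load (λ j → C j i) a))) ⟩
    ∑ˡ (allFin K) (λ i → ∏ (λ s → moment Z (load (λ j → C j i) a s)))
      ≡⟨ ∑ˡ-allFin (λ i → ∏ (λ s → moment Z (load (λ j → C j i) a s))) ⟩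
    ∑ (λ i → ∏ (λ s → moment Z (load (λ j → C j i) a s))) ∎
    where open ≡-Reasoning

  private
    -- Collisions cost a single factor (t + 1) / t. It is weakened to an r-th power to match the
    -- shape of the error from the moments.
    scale-^ : ∀ r t x y → 1 ≤ r → t * x ≤ suc t * y → t ^ r * x ≤ suc t ^ r * y
    scale-^ (suc r) t x y _ h = begin
      t * t ^ r * x          ≡⟨ solve 3 (λ t p x → t :* p :* x := p :* (t :* x)) refl t (t ^ r) x ⟩
      t ^ r * (t * x)        ≤⟨ *-mono-≤ (^-monoˡ-≤ r (n≤1+n t)) h ⟩
      suc t ^ r * (suc t * y) ≡⟨ solve 3 (λ t p x → p :* (t :* x) := t :* p :* x) refl (suc t) (suc t ^ r) y ⟩
      suc t * suc t ^ r * y  ∎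
      where open ≤-Reasoning

    pow-≥1 : ∀ {x} k → 1 ≤ x → 1 ≤ x ^ k
    pow-≥1 {x} k 1≤x = m^n>0 x {{>-nonZero 1≤x}} k

  module _ {r t A B q d k : ℕ} (1≤r : 1 ≤ r) (Z : List ℕ)
    (moments : ∀ j → j ≤ r →
      B ^ j * moment Z j ≤ j ! * A ^ j * length Z ×
      (t * A) ^ j * (j ! * length Z) ≤ (suc t * B) ^ j * moment Z j)
    (C : Vector (Vector (Fin d) k) n) (sep : Separated (t * (r ! * (r * r))) C)
    (k≡ : k * (r ! * length Z ^ d) ≡ q ^ r)
    (a : Vec ℕ n) (|a|≡r : Vec.sum a ≡ r)
    where

    private
      open ≤-Reasoning
      N = length Z
      b : Fin k → Vector ℕ d
      b i = load (λ j → C j i) a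
      ∑b : ∀ i → ∑ (b i) ≡ r
      ∑b i = trans (∑-load (λ j → C j i) a) |a|≡r
      P = ∑ (λ i → ∏ (λ s → moment Z (b i s)))
      Q = ∑ (λ i → ∏ (λ s → b i s !))
      H = coefficient (forms Z C) a
      μ = multinomial a
      H≡ : H ≡ μ * P
      H≡ = cong (μ *_) (∑-forms Z C a)

      -- With exact moments and no collisions, `H` would be μ k a! N^d (A / B)^r. This identity
      -- evaluates that ideal value as (A q / B)^r, which no longer depends on `a`.
      normalise : A ^ r * N ^ d * (μ * (k * a !!)) ≡ (A * q) ^ r
      normalise = begin-equality
        A ^ r * N ^ d * (μ * (k * a !!))    ≡⟨ solve 5 (λ x y μ k f → x :* y :* (μ :* (k :* f)) := x :* (k :* ((μ :* f) :* y))) refl (A ^ r) (N ^ d) μ k (a !!) ⟩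
        A ^ r * (k * (μ * a !! * N ^ d))    ≡⟨ cong (λ x → A ^ r * (k * (x * N ^ d))) (trans (multinomial-!! a) (cong _! |a|≡r)) ⟩
        A ^ r * (k * (r ! * N ^ d))         ≡⟨ cong (A ^ r *_) k≡ ⟩
        A ^ r * q ^ r                       ≡⟨ ^-distribʳ-* A q r ⟨
        (A * q) ^ r                         ∎

      moments-≥ : (t * A) ^ r * (Q * N ^ d) ≤ (suc t * B) ^ r * P
      moments-≥ = begin
        (t * A) ^ r * (Q * N ^ d)                              ≡⟨ cong ((t * A) ^ r *_) (*-distribʳ-sum (N ^ d) (λ i → ∏ (λ s → b i s !))) ⟩
        (t * A) ^ r * ∑ (λ i → ∏ (λ s → b i s !) * N ^ d)      ≡⟨ *-distribˡ-sum ((t * A) ^ r) (λ i → ∏ (λ s → b i s !) * N ^ d) ⟩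
        ∑ (λ i → (t * A) ^ r * (∏ (λ s → b i s !) * N ^ d))    ≤⟨ ∑-mono (λ i → ∏-moment-≥ Z (λ j j≤r → proj₂ (moments j j≤r)) (b i) (∑b i)) ⟩
        ∑ (λ i → (suc t * B) ^ r * ∏ (λ s → moment Z (b i s))) ≡⟨ *-distribˡ-sum ((suc t * B) ^ r) (λ i → ∏ (λ s → moment Z (b i s))) ⟨
        (suc t * B) ^ r * P                                    ∎

      moments-≤ : B ^ r * P ≤ Q * (A ^ r * N ^ d)
      moments-≤ = begin
        B ^ r * P                                              ≡⟨ *-distribˡ-sum (B ^ r) (λ i → ∏ (λ s → moment Z (b i s))) ⟩
        ∑ (λ i → B ^ r * ∏ (λ s → moment Z (b i s)))           ≤⟨ ∑-mono (λ i → ∏-moment-≤ Z (λ j j≤r → proj₁ (moments j j≤r)) (b i) (∑b i)) ⟩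
        ∑ (λ i → ∏ (λ s → b i s !) * (A ^ r * N ^ d))          ≡⟨ *-distribʳ-sum (A ^ r * N ^ d) (λ i → ∏ (λ s → b i s !)) ⟨
        Q * (A ^ r * N ^ d)                                    ∎

    coefficient-≥ : (t * (A * q)) ^ r ≤ (suc t * B) ^ r * H
    coefficient-≥ = begin
      (t * (A * q)) ^ r                             ≡⟨ ^-distribʳ-* t (A * q) r ⟩
      t ^ r * (A * q) ^ r                           ≡⟨ cong (t ^ r *_) normalise ⟨
      t ^ r * (A ^ r * N ^ d * (μ * (k * a !!)))    ≤⟨ *-monoʳ-≤ (t ^ r) (*-monoʳ-≤ (A ^ r * N ^ d) (*-monoʳ-≤ μ (∑∏load!≥ C a))) ⟩
      t ^ r * (A ^ r * N ^ d * (μ * Q))             ≡⟨ solve 5 (λ t a n μ q → t :* (a :* n :* (μ :* q)) := μ :* (t :* a :* (q :* n))) refl (t ^ r) (A ^ r) (N ^ d) μ Q ⟩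
      μ * (t ^ r * A ^ r * (Q * N ^ d))             ≡⟨ cong (λ x → μ * (x * (Q * N ^ d))) (^-distribʳ-* t A r) ⟨
      μ * ((t * A) ^ r * (Q * N ^ d))               ≤⟨ *-monoʳ-≤ μ moments-≥ ⟩
      μ * ((suc t * B) ^ r * P)                     ≡⟨ solve 3 (λ μ x p → μ :* (x :* p) := x :* (μ :* p)) refl μ ((suc t * B) ^ r) P ⟩
      (suc t * B) ^ r * (μ * P)                     ≡⟨ cong ((suc t * B) ^ r *_) H≡ ⟨
      (suc t * B) ^ r * H                           ∎

    coefficient-≤ : (t * B) ^ r * H ≤ (suc t * (A * q)) ^ r
    coefficient-≤ = begin
      (t * B) ^ r * H                               ≡⟨ cong₂ _*_ (^-distribʳ-* t B r) H≡ ⟩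
      t ^ r * B ^ r * (μ * P)                       ≡⟨ solve 4 (λ x b μ p → x :* b :* (μ :* p) := x :* (μ :* (b :* p))) refl (t ^ r) (B ^ r) μ P ⟩
      t ^ r * (μ * (B ^ r * P))                     ≤⟨ *-monoʳ-≤ (t ^ r) (*-monoʳ-≤ μ moments-≤) ⟩
      t ^ r * (μ * (Q * (A ^ r * N ^ d)))           ≤⟨ scale-^ r t _ (A ^ r * N ^ d * (μ * (k * a !!))) 1≤r few-collisions ⟩
      suc t ^ r * (A ^ r * N ^ d * (μ * (k * a !!))) ≡⟨ cong (suc t ^ r *_) normalise ⟩
      suc t ^ r * (A * q) ^ r                       ≡⟨ ^-distribʳ-* (suc t) (A * q) r ⟨
      (suc t * (A * q)) ^ r                         ∎
      where
      few-collisions : t * (μ * (Q * (A ^ r * N ^ d))) ≤ suc t * (A ^ r * N ^ d * (μ * (k * a !!)))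
      few-collisions = begin
        t * (μ * (Q * (A ^ r * N ^ d)))                ≡⟨ solve 4 (λ t μ q y → t :* (μ :* (q :* y)) := y :* μ :* (t :* q)) refl t μ Q (A ^ r * N ^ d) ⟩
        A ^ r * N ^ d * μ * (t * Q)                    ≤⟨ *-monoʳ-≤ (A ^ r * N ^ d * μ) (∑∏load!≤ r t 1≤r C sep a |a|≡r) ⟩
        A ^ r * N ^ d * μ * (suc t * (k * a !!))       ≡⟨ solve 4 (λ y μ t k → y :* μ :* (t :* k) := t :* (y :* (μ :* k))) refl (A ^ r * N ^ d) μ (suc t) (k * a !!) ⟩
        suc t * (A ^ r * N ^ d * (μ * (k * a !!)))     ∎

  private
    alphabet : ∀ τ → 1 ≤ τ → ∃[ m ] 2 + m ≡ 4 ^ τ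
    alphabet τ 1≤τ = 4 ^ τ ∸ 2 , m+[n∸m]≡n (≤-trans (m≤n+m 2 2) (^-monoʳ-≤ 4 1≤τ))

    -- A code of length E^(r-1) q^r makes the normalising constant an r-th power,
    -- so that the forms can be scaled by a rational.
    complete-power : ∀ r E q → 1 ≤ r → E ^ (r ∸ 1) * q ^ r * E ≡ (E * q) ^ r
    complete-power (suc r) E q _ = trans
      (solve 3 (λ x y e → x :* y :* e := e :* x :* y) refl (E ^ r) (q ^ suc r) E) (sym (^-distribʳ-* E q (suc r)))

  -- All coefficients lie within a factor ((t + 1) / t)^r of (G q / B)^r. The constants `G`, `B` and
  -- `c` precede `n`, which is what makes κ depend on r and ε alone; `L` plays the role of log₂ n.
  design : ∀ r t → 1 ≤ r → 1 ≤ t →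
    ∃[ G ] ∃[ B ] ∃[ c ] 1 ≤ G × 1 ≤ B × 1 ≤ c × (∀ n L → 1 ≤ L → n ≤ 2 ^ L →
      ∃[ q ] ∃[ zs ] 1 ≤ q × length zs ≤ c * L × ((a : Vec ℕ n) → Vec.sum a ≡ r →
        (t * (G * q)) ^ r ≤ (suc t * B) ^ r * coefficient zs a ×
        (t * B) ^ r * coefficient zs a ≤ (suc t * (G * q)) ^ r))
  design r t 1≤r 1≤t
    with approximateExponential r t 1≤r 1≤t | alphabet (t * (r ! * (r * r))) (*-mono-≤ 1≤t (*-mono-≤ (1≤n! r) (*-mono-≤ 1≤r 1≤r)))
  ... | Z , A , B , 1≤N , 1≤A , 1≤B , moments | m , m≡ =
    A * E , B , e * 2 ^ r * N ^ d , *-mono-≤ 1≤A 1≤E , 1≤B ,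
    *-mono-≤ (*-mono-≤ 1≤e (m^n>0 2 r)) (pow-≥1 d 1≤N) , build
    where
    d = suc m
    N = length Z
    E = r ! * N ^ d
    e = E ^ (r ∸ 1)
    1≤E : 1 ≤ E
    1≤E = *-mono-≤ (1≤n! r) (pow-≥1 d 1≤N)
    1≤e : 1 ≤ e
    1≤e = pow-≥1 (r ∸ 1) 1≤E
    build : ∀ n L → 1 ≤ L → n ≤ 2 ^ L →
      ∃[ q ] ∃[ zs ] 1 ≤ q × length zs ≤ e * 2 ^ r * N ^ d * L × ((a : Vec ℕ n) → Vec.sum a ≡ r →
        (t * (A * E * q)) ^ r ≤ (suc t * B) ^ r * coefficient zs a ×
        (t * B) ^ r * coefficient zs a ≤ (suc t * (A * E * q)) ^ r)
    build n L 1≤L n≤2^L with root r 1≤r L 1≤L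
    ... | q , 1≤q , L≤q^r , q^r≤ with separatedCode (t * (r ! * (r * r))) m≡ (e * q ^ r) n
             (≤-trans n≤2^L (^-monoʳ-≤ 2 (≤-trans L≤q^r (m≤n*m (q ^ r) e {{>-nonZero 1≤e}}))))
    ... | C , sep = q , forms Z C , 1≤q , few , λ a |a|≡r →
      subst (λ x → (t * x) ^ r ≤ (suc t * B) ^ r * coefficient (forms Z C) a) (sym (*-assoc A E q))
        (coefficient-≥ {t = t} {q = E * q} 1≤r Z moments C sep (complete-power r E q 1≤r) a |a|≡r) ,
      subst (λ x → (t * B) ^ r * coefficient (forms Z C) a ≤ (suc t * x) ^ r) (sym (*-assoc A E q))
        (coefficient-≤ {t = t} {q = E * q} 1≤r Z moments C sep (complete-power r E q 1≤r) a |a|≡r)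
      where
      open ≤-Reasoning
      few : length (forms Z C) ≤ e * 2 ^ r * N ^ d * L
      few = begin
        length (forms Z C)           ≡⟨ length-forms Z C ⟩
        e * q ^ r * N ^ d            ≤⟨ *-monoˡ-≤ (N ^ d) (*-monoʳ-≤ e q^r≤) ⟩
        e * (2 ^ r * L) * N ^ d      ≡⟨ solve 4 (λ e x l n → e :* (x :* l) :* n := e :* x :* n :* l) refl e (2 ^ r) L (N ^ d) ⟩
        e * 2 ^ r * N ^ d * L        ∎

open Combinatorics using (multinomial; power; coefficient; design)
open import Algebra.Bundles using (CommutativeRing; CommutativeSemiring)
open import Data.Fin.Base using (zero; suc; toℕ)
open import Data.List.Base as List using (List; []; _∷_; _++_; map; foldr; length; concatMap; applyUpTo; upTo)
open import Data.List.Membership.Propositional using (_∈_)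
open import Data.List.Membership.Propositional.Properties using (∈-upTo⁻)
open import Data.List.Relation.Unary.Any using (here; there)
open import Data.Nat.Base as ℕ using (ℕ; zero; suc; z≤n; s≤s; _∸_)
open import Data.Nat.Combinatorics using () renaming (_C_ to _choose_)
import Data.Nat.Properties as ℕ
open import Data.Nat.Solver using () renaming (module +-*-Solver to ℕ-Solver)
open import Data.Product.Base using (Σ-syntax; ∃-syntax; _×_; _,_; proj₁; proj₂)
open import Data.Rational.Base as ℚ using (ℚ; mkℚ; 0ℚ; 1ℚ; ½; ∣_∣; _/_; toℚᵘ)
import Data.Rational.Properties as ℚ
open import Data.Rational.Solver using (module +-*-Solver)
open import Data.Rational.Unnormalised.Base as ℚᵘ using (mkℚᵘ; *≤*)
import Data.Rational.Unnormalised.Properties as ℚᵘ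
open import Data.Sum.Base using (inj₁; inj₂)
open import Data.Vec.Base as Vec using (Vec; []; _∷_; lookup)
open import Data.Vec.Functional using (Vector)
open import Function.Base using (_∘_)
open import Relation.Binary.PropositionalEquality using (_≡_; refl; sym; trans; cong; cong₂; subst; subst₂)

open import Defs using (multiIndices; ∈-multiIndices⁻; harmonic; lnSum)

-- The multinomial theorem over a commutative semiring.

module MultinomialTheorem {c ℓ} (S : CommutativeSemiring c ℓ) where

  open CommutativeSemiring S hiding (zero) renaming (refl to ≈-refl; sym to ≈-sym; trans to ≈-trans)
  open import Algebra.Definitions.RawSemiring rawSemiring using (_^_; sum; product)
  open import Algebra.Definitions.RawMonoid (CommutativeSemiring.+-rawMonoid S) using () renaming (_×_ to _·_)
  open import Algebra.Properties.Semiring.Mult semiring using (×-congʳ; ×-congˡ; ×-homo-+; ×-assocˡ; ×-assoc-*; ×-comm-*; ×-homo-1)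
  open import Algebra.Properties.Semiring.Sum semiring using (sum-cong-≋)
  open import Algebra.Properties.CommutativeSemiring.Exp S using (^-distrib-*)
  open import Algebra.Properties.CommutativeSemigroup +-commutativeSemigroup using () renaming (interchange to +-interchange)
  import Algebra.Properties.CommutativeSemiring.Binomial S as Binomial
  open import Relation.Binary.Reasoning.Setoid setoid

  sumOver : ∀ {A : Set} → List A → (A → Carrier) → Carrier
  sumOver xs f = foldr _+_ 0# (map f xs)

  sumOver-cong : ∀ {A : Set} {f g : A → Carrier} xs → (∀ {x} → x ∈ xs → f x ≈ g x) → sumOver xs f ≈ sumOver xs g
  sumOver-cong []       h = ≈-refl
  sumOver-cong (x ∷ xs) h = +-cong (h (here refl)) (sumOver-cong xs (h ∘ there))

  sumOver-++ : ∀ {A : Set} (f : A → Carrier) xs ys → sumOver (xs ++ ys) f ≈ sumOver xs f + sumOver ys f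
  sumOver-++ f []       ys = ≈-sym (+-identityˡ _)
  sumOver-++ f (x ∷ xs) ys = ≈-trans (+-congˡ (sumOver-++ f xs ys)) (≈-sym (+-assoc (f x) _ _))

  sumOver-concatMap : ∀ {A B : Set} (f : B → Carrier) (g : A → List B) xs →
                      sumOver (concatMap g xs) f ≈ sumOver xs (λ x → sumOver (g x) f)
  sumOver-concatMap f g []       = ≈-refl
  sumOver-concatMap f g (x ∷ xs) = ≈-trans (sumOver-++ f (g x) (concatMap g xs)) (+-congˡ (sumOver-concatMap f g xs))

  sumOver-map : ∀ {A B : Set} (f : B → Carrier) (g : A → B) xs → sumOver (map g xs) f ≈ sumOver xs (f ∘ g)
  sumOver-map f g []       = ≈-refl
  sumOver-map f g (x ∷ xs) = +-congˡ (sumOver-map f g xs)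

  sumOver-+ : ∀ {A : Set} (f g : A → Carrier) xs → sumOver xs f + sumOver xs g ≈ sumOver xs (λ x → f x + g x)
  sumOver-+ f g []       = +-identityˡ 0#
  sumOver-+ f g (x ∷ xs) = ≈-trans (+-interchange (f x) _ (g x) _) (+-congˡ (sumOver-+ f g xs))

  sumOver-* : ∀ {A : Set} y (f : A → Carrier) xs → y * sumOver xs f ≈ sumOver xs (λ x → y * f x)
  sumOver-* y f []       = zeroʳ y
  sumOver-* y f (x ∷ xs) = ≈-trans (distribˡ y (f x) _) (+-congˡ (sumOver-* y f xs))

  sumOver-0 : ∀ {A : Set} (xs : List A) → sumOver xs (λ _ → 0#) ≈ 0#
  sumOver-0 []       = ≈-refl
  sumOver-0 (x ∷ xs) = ≈-trans (+-identityˡ _) (sumOver-0 xs)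

  sumOver-· : ∀ {A : Set} n (f : A → Carrier) xs → n · sumOver xs f ≈ sumOver xs (λ x → n · f x)
  sumOver-· zero    f xs = ≈-sym (sumOver-0 xs)
  sumOver-· (suc n) f xs = ≈-trans (+-congˡ (sumOver-· n f xs)) (sumOver-+ f (λ x → n · f x) xs)

  sum-lookup : ∀ {A : Set} (f : A → Carrier) xs → sum (λ i → f (List.lookup xs i)) ≡ sumOver xs f
  sum-lookup f []       = refl
  sum-lookup f (x ∷ xs) = cong (f x +_) (sum-lookup f xs)

  sum-upTo : ∀ (f : ℕ → Carrier) m → sum {m} (f ∘ toℕ) ≡ sumOver (upTo m) f
  sum-upTo f m = go (λ i → i) m
    where
    go : ∀ g m → sum {m} (f ∘ g ∘ toℕ) ≡ sumOver (applyUpTo g m) f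
    go g zero    = refl
    go g (suc m) = cong (f (g 0) +_) (go (g ∘ suc) m)

  ·-*-· : ∀ m n x y → (m · x) * (n · y) ≈ (m ℕ.* n) · (x * y)
  ·-*-· m n x y = begin
    (m · x) * (n · y)    ≈⟨ ×-assoc-* m x (n · y) ⟩
    m · (x * (n · y))    ≈⟨ ×-congʳ m (×-comm-* n x y) ⟩
    m · (n · (x * y))    ≈⟨ ×-assocˡ (x * y) m n ⟩
    (m ℕ.* n) · (x * y)  ∎

  ·-^ : ∀ m x k → (m · x) ^ k ≈ (m ℕ.^ k) · (x ^ k)
  ·-^ m x zero    = ≈-sym (×-homo-1 1#)
  ·-^ m x (suc k) = ≈-trans (*-congˡ (·-^ m x k)) (·-*-· m (m ℕ.^ k) x (x ^ k))

  mono : ∀ {n} → Vector Carrier n → Vec ℕ n → Carrier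
  mono x a = product (λ i → x i ^ lookup a i)

  combination : ∀ {n} → Vector ℕ n → Vector Carrier n → Carrier
  combination z x = sum (λ j → z j · x j)

  term : ∀ {n} → Vector ℕ n → Vector Carrier n → Vec ℕ n → Carrier
  term z x a = (multinomial a ℕ.* power z a) · mono x a

  private
    weights : ∀ c m w p → c ℕ.* (w ℕ.* (m ℕ.* p)) ≡ (c ℕ.* m) ℕ.* (w ℕ.* p)
    weights = solve 4 (λ c m w p → c :* (w :* (m :* p)) := c :* m :* (w :* p)) refl
      where open ℕ-Solver

  -- Splitting off the first variable with the binomial theorem follows the recursions that define
  -- `multiIndices` and `multinomial`.
  multinomialTheorem : ∀ n r (z : Vector ℕ n) (x : Vector Carrier n) →
                       combination z x ^ r ≈ sumOver (multiIndices n r) (term z x)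
  multinomialTheorem zero    zero    z x = ≈-sym (≈-trans (+-identityʳ _) (+-identityʳ _))
  multinomialTheorem zero    (suc r) z x = zeroˡ _
  multinomialTheorem (suc n) r       z x = begin
    (z₀x₀ + rest) ^ r
      ≈⟨ Binomial.theorem r z₀x₀ rest ⟩
    sum {suc r} (λ k → (r choose toℕ k) · (z₀x₀ ^ toℕ k * rest ^ (r ∸ toℕ k)))
      ≡⟨ sum-upTo (λ i → (r choose i) · (z₀x₀ ^ i * rest ^ (r ∸ i))) (suc r) ⟩
    sumOver (upTo (suc r)) (λ i → (r choose i) · (z₀x₀ ^ i * rest ^ (r ∸ i)))
      ≈⟨ sumOver-cong (upTo (suc r)) (λ {i} i∈ → slice i (ℕ.≤-pred (∈-upTo⁻ i∈))) ⟩
    sumOver (upTo (suc r)) (λ i → sumOver (map (i ∷_) (multiIndices n (r ∸ i))) (term z x))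
      ≈⟨ sumOver-concatMap (term z x) (λ i → map (i ∷_) (multiIndices n (r ∸ i))) (upTo (suc r)) ⟨
    sumOver (multiIndices (suc n) r) (term z x) ∎
    where
    z₀x₀ = z zero · x zero
    rest = combination (z ∘ suc) (x ∘ suc)
    t′ = term (z ∘ suc) (x ∘ suc)
    cell : ∀ i a → i ℕ.+ Vec.sum a ≡ r → (r choose i) · (z₀x₀ ^ i * t′ a) ≈ term z x (i ∷ a)
    cell i a refl = begin
      k · (z₀x₀ ^ i * t′ a)
        ≈⟨ ×-congʳ k (*-congʳ (·-^ (z zero) (x zero) i)) ⟩
      k · (((z zero ℕ.^ i) · (x zero ^ i)) * t′ a)
        ≈⟨ ×-congʳ k (·-*-· (z zero ℕ.^ i) (multinomial a ℕ.* power (z ∘ suc) a) (x zero ^ i) (mono (x ∘ suc) a)) ⟩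
      k · ((z zero ℕ.^ i ℕ.* (multinomial a ℕ.* power (z ∘ suc) a)) · mono x (i ∷ a))
        ≈⟨ ×-assocˡ _ k _ ⟩
      (k ℕ.* (z zero ℕ.^ i ℕ.* (multinomial a ℕ.* power (z ∘ suc) a))) · mono x (i ∷ a)
        ≈⟨ ×-congˡ (weights k (multinomial a) (z zero ℕ.^ i) (power (z ∘ suc) a)) ⟩
      term z x (i ∷ a) ∎
      where k = (i ℕ.+ Vec.sum a) choose i
    slice : ∀ i → i ℕ.≤ r → (r choose i) · (z₀x₀ ^ i * rest ^ (r ∸ i)) ≈ sumOver (map (i ∷_) (multiIndices n (r ∸ i))) (term z x)
    slice i i≤r = begin
      k · (z₀x₀ ^ i * rest ^ (r ∸ i))
        ≈⟨ ×-congʳ k (*-congˡ (multinomialTheorem n (r ∸ i) (z ∘ suc) (x ∘ suc))) ⟩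
      k · (z₀x₀ ^ i * sumOver as t′)
        ≈⟨ ×-congʳ k (sumOver-* (z₀x₀ ^ i) t′ as) ⟩
      k · sumOver as (λ a → z₀x₀ ^ i * t′ a)
        ≈⟨ sumOver-· k _ as ⟩
      sumOver as (λ a → k · (z₀x₀ ^ i * t′ a))
        ≈⟨ sumOver-cong as (λ {a} a∈ → cell i a (trans (cong (i ℕ.+_) (∈-multiIndices⁻ n a∈)) (ℕ.m+[n∸m]≡n i≤r))) ⟩
      sumOver as (term z x ∘ (i ∷_))
        ≈⟨ sumOver-map (term z x) (i ∷_) as ⟨
      sumOver (map (i ∷_) as) (term z x) ∎
      where
      k = r choose i
      as = multiIndices n (r ∸ i)

  -- Over the reals the right-hand side unfolds to `homogeneous`, so the identity transfers as it
  -- stands.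
  sumOfPowers : ∀ n r y (zs : List (Vector ℕ n)) (x : Vector Carrier n) →
                sumOver zs (λ z → (y * combination z x) ^ r) ≈
                sumOver (multiIndices n r) (λ a → (y ^ r * (coefficient zs a · 1#)) * mono x a)
  sumOfPowers n r y []       x = ≈-sym (≈-trans (sumOver-cong (multiIndices n r) (λ {a} _ → vanish a)) (sumOver-0 (multiIndices n r)))
    where
    vanish : ∀ a → (y ^ r * (coefficient [] a · 1#)) * mono x a ≈ 0#
    vanish a = ≈-trans (*-congʳ (≈-trans (*-congˡ (×-congˡ (ℕ.*-zeroʳ (multinomial a)))) (zeroʳ (y ^ r)))) (zeroˡ (mono x a))
  sumOfPowers n r y (z ∷ zs) x = begin
    (y * combination z x) ^ r + sumOver zs (λ z → (y * combination z x) ^ r)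
      ≈⟨ +-cong (≈-trans (^-distrib-* y _ r) (*-congˡ (multinomialTheorem n r z x))) (sumOfPowers n r y zs x) ⟩
    y ^ r * sumOver as (term z x) + sumOver as (λ a → (y ^ r * (coefficient zs a · 1#)) * mono x a)
      ≈⟨ +-congʳ (sumOver-* (y ^ r) (term z x) as) ⟩
    sumOver as (λ a → y ^ r * term z x a) + sumOver as (λ a → (y ^ r * (coefficient zs a · 1#)) * mono x a)
      ≈⟨ sumOver-+ (λ a → y ^ r * term z x a) _ as ⟩
    sumOver as (λ a → y ^ r * term z x a + (y ^ r * (coefficient zs a · 1#)) * mono x a)
      ≈⟨ sumOver-cong as (λ {a} _ → merge a) ⟩
    sumOver as (λ a → (y ^ r * (coefficient (z ∷ zs) a · 1#)) * mono x a) ∎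
    where
    as = multiIndices n r
    merge : ∀ a → y ^ r * term z x a + (y ^ r * (coefficient zs a · 1#)) * mono x a ≈ (y ^ r * (coefficient (z ∷ zs) a · 1#)) * mono x a
    merge a = begin
      y ^ r * (c₁ · X) + (y ^ r * (c₂ · 1#)) * X
        ≈⟨ +-congʳ (≈-trans (*-congˡ (≈-sym (≈-trans (×-assoc-* c₁ 1# X) (×-congʳ c₁ (*-identityˡ X))))) (≈-sym (*-assoc _ _ _))) ⟩
      (y ^ r * (c₁ · 1#)) * X + (y ^ r * (c₂ · 1#)) * X
        ≈⟨ distribʳ X _ _ ⟨
      (y ^ r * (c₁ · 1#) + y ^ r * (c₂ · 1#)) * X
        ≈⟨ *-congʳ (distribˡ (y ^ r) _ _) ⟨
      (y ^ r * (c₁ · 1# + c₂ · 1#)) * X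
        ≈⟨ *-congʳ (*-congˡ (×-homo-+ 1# c₁ c₂)) ⟨
      (y ^ r * ((c₁ ℕ.+ c₂) · 1#)) * X
        ≈⟨ *-congʳ (*-congˡ (×-congˡ (sym (ℕ.*-distribˡ-+ (multinomial a) _ _)))) ⟩
      (y ^ r * (coefficient (z ∷ zs) a · 1#)) * X ∎
      where
      X = mono x a
      c₁ = multinomial a ℕ.* power z a
      c₂ = coefficient zs a

-- Linearity of scaled combinations.

module ScaledCombination {c ℓ} (R : CommutativeRing c ℓ) where

  open CommutativeRing R renaming (refl to ≈-refl; sym to ≈-sym; trans to ≈-trans) hiding (zero)
  open MultinomialTheorem commutativeSemiring
  open import Algebra.Properties.CommutativeMonoid.Mult +-commutativeMonoid using (×-distrib-+)
  open import Algebra.Properties.Semiring.Mult semiring using (×-congʳ; ×-comm-*)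
  open import Algebra.Properties.Semiring.Sum semiring using (sum-cong-≋; ∑-distrib-+; *-distribˡ-sum)
  open import Algebra.Properties.Ring ring using (-1*x≈-x)
  open import Algebra.Definitions.RawMonoid +-rawMonoid using () renaming (_×_ to _·_)

  scaled : ∀ {n} → Carrier → Vector ℕ n → Vector Carrier n → Carrier
  scaled y z x = y * combination z x

  module _ {n} (y : Carrier) (z : Vector ℕ n) where

    scaled-cong : ∀ {x x′ : Vector Carrier n} → (∀ j → x j ≈ x′ j) → scaled y z x ≈ scaled y z x′
    scaled-cong eq = *-congˡ (sum-cong-≋ (λ j → ×-congʳ (z j) (eq j)))

    scaled-+ : ∀ x x′ → scaled y z (λ j → x j + x′ j) ≈ scaled y z x + scaled y z x′
    scaled-+ x x′ = ≈-trans (*-congˡ (≈-trans (sum-cong-≋ (λ j → ×-distrib-+ (x j) (x′ j) (z j))) (∑-distrib-+ (λ j → z j · x j) (λ j → z j · x′ j))))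
      (distribˡ y _ _)

    scaled-* : ∀ a x → scaled y z (λ j → a * x j) ≈ a * scaled y z x
    scaled-* a x = ≈-trans (*-congˡ {y} (≈-trans (sum-cong-≋ (λ j → ≈-sym (×-comm-* (z j) a (x j)))) (≈-sym (*-distribˡ-sum a (λ j → z j · x j)))))
      (≈-trans (≈-sym (*-assoc y a _)) (≈-trans (*-congʳ (*-comm y a)) (*-assoc a y _)))

    scaled-0 : scaled y z (λ _ → 0#) ≈ 0#
    scaled-0 = ≈-trans (scaled-cong (λ _ → ≈-sym (zeroˡ 0#))) (≈-trans (scaled-* 0# (λ _ → 0#)) (zeroˡ _))

    scaled-neg : ∀ x → scaled y z (λ j → - x j) ≈ - scaled y z x
    scaled-neg x = ≈-trans (scaled-cong (λ j → ≈-sym (-1*x≈-x (x j)))) (≈-trans (scaled-* (- 1#) x) (-1*x≈-x _))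

open import Data.Integer.Base as ℤ using (+_; -[1+_])
import Data.Integer.Properties as ℤ

-- Fractions, harmonic numbers and a lower bound for the logarithm.

toℚᵘ-/ : ∀ a b → toℚᵘ (+ a / suc b) ℚᵘ.≃ mkℚᵘ (+ a) b
toℚᵘ-/ a b = ℚ.toℚᵘ-fromℚᵘ (mkℚᵘ (+ a) b)

/-mono : ∀ a b c d → a ℕ.* suc d ℕ.≤ c ℕ.* suc b → + a / suc b ℚ.≤ + c / suc d
/-mono a b c d h = ℚ.toℚᵘ-cancel-≤
  (ℚᵘ.≤-respˡ-≃ (ℚᵘ.≃-sym (toℚᵘ-/ a b)) (ℚᵘ.≤-respʳ-≃ (ℚᵘ.≃-sym (toℚᵘ-/ c d))
    (*≤* (subst₂ ℤ._≤_ (ℤ.pos-* a (suc d)) (ℤ.pos-* c (suc b)) (ℤ.+≤+ h)))))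

/-cong : ∀ a b c d → a ℕ.* suc d ≡ c ℕ.* suc b → + a / suc b ≡ + c / suc d
/-cong a b c d eq = ℚ.≤-antisym (/-mono a b c d (ℕ.≤-reflexive eq)) (/-mono c d a b (ℕ.≤-reflexive (sym eq)))

/-+ : ∀ a b c d → + a / suc b ℚ.+ + c / suc d ≡ + (a ℕ.* suc d ℕ.+ c ℕ.* suc b) / (suc b ℕ.* suc d)
/-+ a b c d = ℚ.toℚᵘ-injective (ℚᵘ.≃-trans (ℚ.toℚᵘ-homo-+ (+ a / suc b) (+ c / suc d))
  (ℚᵘ.≃-trans (ℚᵘ.+-cong (toℚᵘ-/ a b) (toℚᵘ-/ c d))
    (ℚᵘ.≃-trans (ℚᵘ.≃-reflexive (cong (λ n → mkℚᵘ n (d ℕ.+ b ℕ.* suc d)) (sym (trans (ℤ.pos-+ (a ℕ.* suc d) _) (cong₂ ℤ._+_ (ℤ.pos-* a (suc d)) (ℤ.pos-* c (suc b)))))))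
      (ℚᵘ.≃-sym (toℚᵘ-/ (a ℕ.* suc d ℕ.+ c ℕ.* suc b) (d ℕ.+ b ℕ.* suc d))))))

/-* : ∀ a b c d → (+ a / suc b) ℚ.* (+ c / suc d) ≡ + (a ℕ.* c) / (suc b ℕ.* suc d)
/-* a b c d = ℚ.toℚᵘ-injective (ℚᵘ.≃-trans (ℚ.toℚᵘ-homo-* (+ a / suc b) (+ c / suc d))
  (ℚᵘ.≃-trans (ℚᵘ.*-cong (toℚᵘ-/ a b) (toℚᵘ-/ c d))
    (ℚᵘ.≃-trans (ℚᵘ.≃-reflexive (cong (λ n → mkℚᵘ n (d ℕ.+ b ℕ.* suc d)) (sym (ℤ.pos-* a c))))
      (ℚᵘ.≃-sym (toℚᵘ-/ (a ℕ.* c) (d ℕ.+ b ℕ.* suc d))))))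

/-suc : ∀ j k → + j / suc k ℚ.+ + 1 / suc k ≡ + suc j / suc k
/-suc j k = trans (/-+ j k 1 k) (/-cong (j ℕ.* suc k ℕ.+ 1 ℕ.* suc k) (k ℕ.+ k ℕ.* suc k) (suc j) k (solve 2 (λ j k → (j :* (con 1 :+ k) :+ con 1 :* (con 1 :+ k)) :* (con 1 :+ k)
  := (con 1 :+ j) :* ((con 1 :+ k) :* (con 1 :+ k))) refl j k))
  where open ℕ-Solver

/-nonNeg : ∀ a b → 0ℚ ℚ.≤ + a / suc b
/-nonNeg a b = /-mono 0 0 a b z≤n

harmonic-mono : ∀ {m n} → m ℕ.≤ n → harmonic m ℚ.≤ harmonic n
harmonic-mono m≤n = go (ℕ.≤⇒≤′ m≤n)
  where
  go : ∀ {m n} → m ℕ.≤′ n → harmonic m ℚ.≤ harmonic n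
  go ℕ.≤′-refl = ℚ.≤-refl
  go {m} (ℕ.≤′-step {n} h) = ℚ.≤-trans (go h)
    (subst (ℚ._≤ harmonic (suc n)) (ℚ.+-identityʳ (harmonic n)) (ℚ.+-monoʳ-≤ (harmonic n) (/-nonNeg 1 n)))

harmonic-+ : ∀ m k j → j ℕ.+ m ℕ.≤ suc k → harmonic m ℚ.+ + j / suc k ℚ.≤ harmonic (j ℕ.+ m)
harmonic-+ m k zero    _ = ℚ.≤-reflexive (trans (cong (harmonic m ℚ.+_) (ℚ.0/n≡0 (suc k))) (ℚ.+-identityʳ (harmonic m)))
harmonic-+ m k (suc j) h = begin
  harmonic m ℚ.+ + suc j / suc k                        ≡⟨ cong (harmonic m ℚ.+_) (/-suc j k) ⟨
  harmonic m ℚ.+ (+ j / suc k ℚ.+ + 1 / suc k)          ≡⟨ ℚ.+-assoc (harmonic m) _ _ ⟨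
  harmonic m ℚ.+ + j / suc k ℚ.+ + 1 / suc k            ≤⟨ ℚ.+-mono-≤ (harmonic-+ m k j (ℕ.<⇒≤ h)) (/-mono 1 k 1 (j ℕ.+ m) (ℕ.*-monoʳ-≤ 1 h)) ⟩
  harmonic (suc j ℕ.+ m)                                ∎
  where open ℚ.≤-Reasoning

-- Oresme's block argument: the m + 1 new terms are each at least 1 / (2 (m + 1)).
harmonic-double : ∀ m → harmonic (suc m) ℚ.+ ½ ℚ.≤ harmonic (2 ℕ.* suc m)
harmonic-double m = subst (λ n → harmonic (suc m) ℚ.+ ½ ℚ.≤ harmonic n) (cong (suc m ℕ.+_) (sym (ℕ.+-identityʳ (suc m))))
  (ℚ.≤-trans (ℚ.+-monoʳ-≤ (harmonic (suc m)) (/-mono 1 1 (suc m) (m ℕ.+ suc m)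
    (ℕ.≤-reflexive (solve 1 (λ m → con 1 :* (con 1 :+ m :+ (con 1 :+ m)) := (con 1 :+ m) :* con 2) refl m))))
    (harmonic-+ (suc m) (m ℕ.+ suc m) (suc m) ℕ.≤-refl))
  where open ℕ-Solver

harmonic-2^ : ∀ l q → harmonic (suc q) ℚ.+ + l / 2 ℚ.≤ harmonic (2 ℕ.^ l ℕ.* suc q)
harmonic-2^ zero    q = ℚ.≤-reflexive (trans (ℚ.+-identityʳ (harmonic (suc q))) (cong harmonic (sym (ℕ.*-identityˡ (suc q)))))
harmonic-2^ (suc l) q = begin
  harmonic (suc q) ℚ.+ + suc l / 2                 ≡⟨ cong (harmonic (suc q) ℚ.+_) (/-suc l 1) ⟨
  harmonic (suc q) ℚ.+ (+ l / 2 ℚ.+ ½)             ≡⟨ ℚ.+-assoc (harmonic (suc q)) _ _ ⟨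
  harmonic (suc q) ℚ.+ + l / 2 ℚ.+ ½               ≤⟨ ℚ.+-monoˡ-≤ ½ (harmonic-2^ l q) ⟩
  harmonic (2 ℕ.^ l ℕ.* suc q) ℚ.+ ½               ≤⟨ step (ℕ.>-nonZero (ℕ.*-mono-≤ (ℕ.m^n>0 2 l) (s≤s z≤n))) ⟩
  harmonic (2 ℕ.* (2 ℕ.^ l ℕ.* suc q))             ≡⟨ cong harmonic (ℕ.*-assoc 2 (2 ℕ.^ l) (suc q)) ⟨
  harmonic (2 ℕ.^ suc l ℕ.* suc q)                 ∎
  where
  open ℚ.≤-Reasoning
  step : ∀ {m} → ℕ.NonZero m → harmonic m ℚ.+ ½ ℚ.≤ harmonic (2 ℕ.* m)
  step {suc m} _ = harmonic-double m

-- A crude form of ln 2 ≥ 1/2, valid for every Riemann sum and not only in the limit.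
lnSum-≥ : ∀ l n q → 2 ℕ.^ l ℕ.≤ n → + l / 2 ℚ.≤ lnSum n q
lnSum-≥ l n q h = begin
  + l / 2                                              ≡⟨ solve 2 (λ x y → y := (x :+ y) :- x) refl (harmonic (suc q)) (+ l / 2) ⟩
  harmonic (suc q) ℚ.+ + l / 2 ℚ.- harmonic (suc q)    ≤⟨ ℚ.+-monoˡ-≤ (ℚ.- harmonic (suc q)) (ℚ.≤-trans (harmonic-2^ l q) (harmonic-mono (ℕ.*-monoˡ-≤ (suc q) h))) ⟩
  lnSum n q                                            ∎
  where
  open ℚ.≤-Reasoning
  open +-*-Solver

log₂ : ∀ n → 2 ℕ.≤ n → ∃[ l ] 1 ℕ.≤ l × 2 ℕ.^ l ℕ.≤ n × n ℕ.< 2 ℕ.^ suc l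
log₂ (suc (suc zero)) _ = 1 , ℕ.≤-refl , ℕ.≤-refl , ℕ.n≤1+n 3
log₂ (suc n@(suc (suc _))) _ with log₂ n (s≤s (s≤s z≤n))
... | l , 1≤l , ≤n , n< with ℕ.m≤n⇒m<n∨m≡n n<
...   | inj₁ lt = l , 1≤l , ℕ.m≤n⇒m≤1+n ≤n , lt
...   | inj₂ eq = suc l , s≤s z≤n , ℕ.≤-reflexive (sym eq) ,
  subst (ℕ._< 2 ℕ.^ suc (suc l)) (sym eq) (ℕ.^-monoʳ-< 2 (s≤s (s≤s z≤n)) (ℕ.n<1+n (suc l)))
log₂ (suc zero) (s≤s ())

open CommutativeRing ℚ.+-*-commutativeRing using () renaming (commutativeSemiring to ℚ-commutativeSemiring)
open import Algebra.Properties.CommutativeSemiring.Exp ℚ-commutativeSemiring using (^-distrib-*) renaming (_^_ to _^ᵠ_)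

-- Powers of rationals and the embedding of the naturals.

^-nonNeg : ∀ {x} r → 0ℚ ℚ.≤ x → 0ℚ ℚ.≤ x ^ᵠ r
^-nonNeg zero    _   = /-nonNeg 1 0
^-nonNeg {x} (suc r) 0≤x = ℚ.nonNegative⁻¹ (x ℚ.* x ^ᵠ r)
  {{ℚ.nonNeg*nonNeg⇒nonNeg x {{ℚ.nonNegative 0≤x}} (x ^ᵠ r) {{ℚ.nonNegative (^-nonNeg r 0≤x)}}}}

^-pos : ∀ {x} r → 0ℚ ℚ.< x → 0ℚ ℚ.< x ^ᵠ r
^-pos zero    _   = ℚ.positive⁻¹ 1ℚ
^-pos {x} (suc r) 0<x = ℚ.positive⁻¹ (x ℚ.* x ^ᵠ r)
  {{ℚ.pos*pos⇒pos x {{ℚ.positive 0<x}} (x ^ᵠ r) {{ℚ.positive (^-pos r 0<x)}}}}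

*-mono-≤ : ∀ {w x y z} → 0ℚ ℚ.≤ y → 0ℚ ℚ.≤ x → w ℚ.≤ x → y ℚ.≤ z → w ℚ.* y ℚ.≤ x ℚ.* z
*-mono-≤ {x = x} {y} 0≤y 0≤x w≤x y≤z = ℚ.≤-trans (ℚ.*-monoʳ-≤-nonNeg y {{ℚ.nonNegative 0≤y}} w≤x)
  (ℚ.*-monoˡ-≤-nonNeg x {{ℚ.nonNegative 0≤x}} y≤z)

^-mono-≤ : ∀ {x y} r → 0ℚ ℚ.≤ x → x ℚ.≤ y → x ^ᵠ r ℚ.≤ y ^ᵠ r
^-mono-≤ zero    _   _   = ℚ.≤-refl
^-mono-≤ (suc r) 0≤x x≤y = *-mono-≤ (^-nonNeg r 0≤x) (ℚ.≤-trans 0≤x x≤y) x≤y (^-mono-≤ r 0≤x x≤y)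

∣^∣ : ∀ x r → ∣ x ^ᵠ r ∣ ≡ ∣ x ∣ ^ᵠ r
∣^∣ x zero    = refl
∣^∣ x (suc r) = trans (ℚ.∣p*q∣≡∣p∣*∣q∣ x (x ^ᵠ r)) (cong (∣ x ∣ ℚ.*_) (∣^∣ x r))

p≤∣p∣ : ∀ p → p ℚ.≤ ∣ p ∣
p≤∣p∣ p with ℚ.∣p∣≡p∨∣p∣≡-p p
... | inj₁ eq = ℚ.≤-reflexive (sym eq)
... | inj₂ eq = ℚ.≤-trans (subst (ℚ._≤ 0ℚ) (solve 1 (λ p → :- (:- p) := p) refl p) (ℚ.neg-antimono-≤ (subst (0ℚ ℚ.≤_) eq (ℚ.0≤∣p∣ p)))) (ℚ.0≤∣p∣ p)
  where open +-*-Solver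

-- Here `x` may be negative, as 1 - ε is for ε > 1; passing through the absolute value treats both
-- parities of `r` at once.
^-≤-∣∣ : ∀ {x u} r → ∣ x ∣ ℚ.≤ u → x ^ᵠ r ℚ.≤ u ^ᵠ r
^-≤-∣∣ {x} r h = ℚ.≤-trans (p≤∣p∣ (x ^ᵠ r)) (subst (ℚ._≤ _) (sym (∣^∣ x r)) (^-mono-≤ r (ℚ.0≤∣p∣ x) h))

ι : ℕ → ℚ
ι n = + n / 1

ι-* : ∀ m n → ι (m ℕ.* n) ≡ ι m ℚ.* ι n
ι-* m n = sym (/-* m 0 n 0)

ι-+ : ∀ m n → ι (m ℕ.+ n) ≡ ι m ℚ.+ ι n
ι-+ m n = trans (cong₂ (λ a b → + (a ℕ.+ b) / 1) (sym (ℕ.*-identityʳ m)) (sym (ℕ.*-identityʳ n))) (sym (/-+ m 0 n 0))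

ι-mono : ∀ {m n} → m ℕ.≤ n → ι m ℚ.≤ ι n
ι-mono {m} {n} m≤n = /-mono m 0 n 0 (ℕ.*-monoˡ-≤ 1 m≤n)

ι-pos : ∀ {n} → 1 ℕ.≤ n → 0ℚ ℚ.< ι n
ι-pos 1≤n = ℚ.<-≤-trans (ℚ.positive⁻¹ 1ℚ) (ι-mono 1≤n)

ι-^ : ∀ m r → ι (m ℕ.^ r) ≡ ι m ^ᵠ r
ι-^ m zero    = refl
ι-^ m (suc r) = trans (ι-* m (m ℕ.^ r)) (cong (ι m ℚ.*_) (ι-^ m r))

ι-≥ : ∀ p → ∃[ n ] 1 ℕ.≤ n × p ℚ.≤ ι n
ι-≥ p@(mkℚ -[1+ _ ] _ _) = 1 , ℕ.≤-refl , ℚ.≤-trans (ℚ.<⇒≤ (ℚ.negative⁻¹ p)) (/-nonNeg 1 0)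
ι-≥ p@(mkℚ (+ a) d _) = suc a , s≤s z≤n , ℚ.toℚᵘ-cancel-≤ (ℚᵘ.≤-respʳ-≃ (ℚᵘ.≃-sym (toℚᵘ-/ (suc a) 0))
  (*≤* (subst₂ ℤ._≤_ (ℤ.pos-* a 1) (ℤ.pos-* (suc a) (suc d)) (ℤ.+≤+ (ℕ.*-mono-≤ (ℕ.n≤1+n a) (s≤s z≤n))))))

open import Defs

-- Choosing a rational scale that fits all coefficients.

module _ {V S S′ B Γ M η : ℚ} (0≤V : 0ℚ ℚ.≤ V) (0≤S : 0ℚ ℚ.≤ S) (0<S′ : 0ℚ ℚ.< S′) (0<Γ : 0ℚ ℚ.< Γ)
  (M≡ : M ℚ.* (S′ ℚ.* Γ) ≡ V ℚ.* (S ℚ.* B)) where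

  private
    open +-*-Solver
    open ℚ.≤-Reasoning
    W = S′ ℚ.* Γ
    instance
      S′-pos = ℚ.positive 0<S′
      Γ-pos = ℚ.positive 0<Γ
      W-pos = ℚ.pos*pos⇒pos S′ Γ
      W′-pos = ℚ.pos*pos⇒pos W S′
      Γ-nonNeg = ℚ.pos⇒nonNeg Γ
      V-nonNeg = ℚ.nonNegative 0≤V
      S-nonNeg = ℚ.nonNegative 0≤S
      VS-nonNeg = ℚ.nonNeg*nonNeg⇒nonNeg V S

  -- In `rescale` the capitals become the r-th powers of the corresponding lower-case quantities,
  -- with `η` the unscaled coefficient.
  rescale-≤ : (S ℚ.* B) ℚ.* η ℚ.≤ S′ ℚ.* Γ → M ℚ.* η ℚ.≤ V
  rescale-≤ h = ℚ.*-cancelʳ-≤-pos W (begin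
    M ℚ.* η ℚ.* W                ≡⟨ solve 3 (λ m n w → m :* n :* w := m :* w :* n) refl M η W ⟩
    M ℚ.* W ℚ.* η                ≡⟨ cong (ℚ._* η) M≡ ⟩
    V ℚ.* (S ℚ.* B) ℚ.* η        ≡⟨ ℚ.*-assoc V (S ℚ.* B) η ⟩
    V ℚ.* ((S ℚ.* B) ℚ.* η)      ≤⟨ ℚ.*-monoˡ-≤-nonNeg V h ⟩
    V ℚ.* W                      ∎)

  rescale-≥ : ∀ {U} → U ℚ.* (S′ ℚ.* S′) ℚ.≤ V ℚ.* (S ℚ.* S) → S ℚ.* Γ ℚ.≤ (S′ ℚ.* B) ℚ.* η → U ℚ.≤ M ℚ.* η
  rescale-≥ {U} g h = ℚ.*-cancelʳ-≤-pos (W ℚ.* S′) (begin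
    U ℚ.* (W ℚ.* S′)                   ≡⟨ solve 3 (λ u s g → u :* (s :* g :* s) := u :* (s :* s) :* g) refl U S′ Γ ⟩
    U ℚ.* (S′ ℚ.* S′) ℚ.* Γ            ≤⟨ ℚ.*-monoʳ-≤-nonNeg Γ g ⟩
    V ℚ.* (S ℚ.* S) ℚ.* Γ              ≡⟨ solve 3 (λ v s g → v :* (s :* s) :* g := v :* s :* (s :* g)) refl V S Γ ⟩
    V ℚ.* S ℚ.* (S ℚ.* Γ)              ≤⟨ ℚ.*-monoˡ-≤-nonNeg (V ℚ.* S) h ⟩
    V ℚ.* S ℚ.* ((S′ ℚ.* B) ℚ.* η)     ≡⟨ solve 5 (λ v s t b n → v :* s :* (t :* b :* n) := v :* (s :* b) :* (t :* n)) refl V S S′ B η ⟩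
    V ℚ.* (S ℚ.* B) ℚ.* (S′ ℚ.* η)     ≡⟨ cong (ℚ._* (S′ ℚ.* η)) M≡ ⟨
    M ℚ.* W ℚ.* (S′ ℚ.* η)             ≡⟨ solve 4 (λ m w t n → m :* w :* (t :* n) := m :* n :* (w :* t)) refl M W S′ η ⟩
    M ℚ.* η ℚ.* (W ℚ.* S′)             ∎)

-- The scale μ = v s β / (s′ γ) makes the largest admissible coefficient exactly v^r. The smallest
-- one then becomes (v s² / s′²)^r, and the hypothesis relating `u` and `v` keeps it above u^r.
rescale : ∀ r {u v s s′ β γ μ η} → 0ℚ ℚ.≤ u → 0ℚ ℚ.≤ v → 0ℚ ℚ.≤ s → 0ℚ ℚ.< s′ → 0ℚ ℚ.< γ →
          μ ℚ.* (s′ ℚ.* γ) ≡ v ℚ.* (s ℚ.* β) → u ℚ.* (s′ ℚ.* s′) ℚ.≤ v ℚ.* (s ℚ.* s) →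
          (s ℚ.* γ) ^ᵠ r ℚ.≤ (s′ ℚ.* β) ^ᵠ r ℚ.* η → (s ℚ.* β) ^ᵠ r ℚ.* η ℚ.≤ (s′ ℚ.* γ) ^ᵠ r →
          u ^ᵠ r ℚ.≤ μ ^ᵠ r ℚ.* η × μ ^ᵠ r ℚ.* η ℚ.≤ v ^ᵠ r
rescale r {u} {v} {s} {s′} {β} {γ} {μ} {η} 0≤u 0≤v 0≤s 0<s′ 0<γ μ≡ gap lo hi =
  rescale-≥ {M = μ ^ᵠ r} 0≤V 0≤S 0<S′ 0<Γ M≡ G (subst₂ (λ x y → x ℚ.≤ y ℚ.* η) (^-distrib-* s γ r) (^-distrib-* s′ β r) lo) ,
  rescale-≤ {M = μ ^ᵠ r} 0≤V 0≤S 0<S′ 0<Γ M≡ (subst₂ (λ x y → x ℚ.* η ℚ.≤ y) (^-distrib-* s β r) (^-distrib-* s′ γ r) hi)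
  where
  0≤V = ^-nonNeg r 0≤v
  0≤S = ^-nonNeg r 0≤s
  0<S′ = ^-pos r 0<s′
  0<Γ = ^-pos r 0<γ
  distrib₃ : ∀ x y z → (x ℚ.* (y ℚ.* z)) ^ᵠ r ≡ x ^ᵠ r ℚ.* (y ^ᵠ r ℚ.* z ^ᵠ r)
  distrib₃ x y z = trans (^-distrib-* x (y ℚ.* z) r) (cong (x ^ᵠ r ℚ.*_) (^-distrib-* y z r))
  M≡ : μ ^ᵠ r ℚ.* (s′ ^ᵠ r ℚ.* γ ^ᵠ r) ≡ v ^ᵠ r ℚ.* (s ^ᵠ r ℚ.* β ^ᵠ r)
  M≡ = trans (sym (distrib₃ μ s′ γ)) (trans (cong (_^ᵠ r) μ≡) (distrib₃ v s β))
  G : u ^ᵠ r ℚ.* (s′ ^ᵠ r ℚ.* s′ ^ᵠ r) ℚ.≤ v ^ᵠ r ℚ.* (s ^ᵠ r ℚ.* s ^ᵠ r)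
  G = subst₂ ℚ._≤_ (distrib₃ u s′ s′) (distrib₃ v s s) (^-mono-≤ r
    (ℚ.nonNegative⁻¹ _ {{ℚ.nonNeg*nonNeg⇒nonNeg u {{ℚ.nonNegative 0≤u}} (s′ ℚ.* s′) {{ℚ.pos⇒nonNeg (s′ ℚ.* s′) {{ℚ.pos*pos⇒pos s′ {{ℚ.positive 0<s′}} s′ {{ℚ.positive 0<s′}}}}}}}}) gap)

divide : ∀ y x → 0ℚ ℚ.< y → ∃[ z ] z ℚ.* y ≡ x
divide y x 0<y = x ℚ.* (ℚ.1/ y) , trans (ℚ.*-assoc x (ℚ.1/ y) y) (trans (cong (x ℚ.*_) (ℚ.*-inverseˡ y)) (ℚ.*-identityʳ x))
  where instance _ = ℚ.pos⇒nonZero y {{ℚ.positive 0<y}}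

-- The squares account for the two losses, one at each end. As (t + 1)² ≤ t² + 3 t for t ≥ 1, any
-- such t ≥ 3 u / (v - u) suffices.
precision : ∀ {u v} → 0ℚ ℚ.≤ u → u ℚ.< v → ∃[ t ] 1 ℕ.≤ t × u ℚ.* (ι (suc t) ℚ.* ι (suc t)) ℚ.≤ v ℚ.* (ι t ℚ.* ι t)
precision {u} {v} 0≤u u<v with divide (v ℚ.- u) (ι 3 ℚ.* u) 0<d
  where
  0<d : 0ℚ ℚ.< v ℚ.- u
  0<d = subst (ℚ._< v ℚ.- u) (ℚ.+-inverseʳ u) (ℚ.+-monoˡ-< (ℚ.- u) u<v)
... | z , z≡ with ι-≥ z
... | t , 1≤t , z≤t = t , 1≤t , (begin
  u ℚ.* (ι (suc t) ℚ.* ι (suc t))              ≡⟨ cong (u ℚ.*_) (sym (ι-* (suc t) (suc t))) ⟩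
  u ℚ.* ι (suc t ℕ.* suc t)                    ≤⟨ ℚ.*-monoˡ-≤-nonNeg u (ι-mono square) ⟩
  u ℚ.* ι (t ℕ.* t ℕ.+ 3 ℕ.* t)                ≡⟨ cong (u ℚ.*_) (trans (ι-+ (t ℕ.* t) (3 ℕ.* t)) (cong₂ ℚ._+_ (ι-* t t) (ι-* 3 t))) ⟩
  u ℚ.* (T ℚ.* T ℚ.+ ι 3 ℚ.* T)                ≡⟨ solve 3 (λ u t k → u :* (t :* t :+ k :* t) := u :* (t :* t) :+ k :* u :* t) refl u T (ι 3) ⟩
  u ℚ.* (T ℚ.* T) ℚ.+ ι 3 ℚ.* u ℚ.* T          ≡⟨ cong (λ x → u ℚ.* (T ℚ.* T) ℚ.+ x ℚ.* T) z≡ ⟨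
  u ℚ.* (T ℚ.* T) ℚ.+ z ℚ.* (v ℚ.- u) ℚ.* T    ≤⟨ ℚ.+-monoʳ-≤ (u ℚ.* (T ℚ.* T)) (ℚ.*-monoʳ-≤-nonNeg T (ℚ.*-monoʳ-≤-nonNeg (v ℚ.- u) z≤t)) ⟩
  u ℚ.* (T ℚ.* T) ℚ.+ T ℚ.* (v ℚ.- u) ℚ.* T    ≡⟨ solve 3 (λ u v t → u :* (t :* t) :+ t :* (v :- u) :* t := v :* (t :* t)) refl u v T ⟩
  v ℚ.* (T ℚ.* T)                              ∎)
  where
  open ℚ.≤-Reasoning
  open +-*-Solver
  T = ι t
  instance
    _ = ℚ.nonNegative 0≤u
    _ = ℚ.nonNegative (/-nonNeg t 0)
    _ = ℚ.nonNegative {v ℚ.- u} (ℚ.<⇒≤ (subst (ℚ._< v ℚ.- u) (ℚ.+-inverseʳ u) (ℚ.+-monoˡ-< (ℚ.- u) u<v)))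
  square : suc t ℕ.* suc t ℕ.≤ t ℕ.* t ℕ.+ 3 ℕ.* t
  square = ℕ.≤-trans (ℕ.≤-reflexive (N.solve 1 (λ t → (N.con 1 N.:+ t) N.:* (N.con 1 N.:+ t) N.:= t N.:* t N.:+ (N.con 2 N.:* t N.:+ N.con 1)) refl t))
    (ℕ.+-monoʳ-≤ (t ℕ.* t) (ℕ.≤-trans (ℕ.+-monoʳ-≤ (2 ℕ.* t) 1≤t) (ℕ.≤-reflexive (N.solve 1 (λ t → N.con 2 N.:* t N.:+ t N.:= N.con 3 N.:* t) refl t))))
    where module N = ℕ-Solver

-- From rational estimates to the reals.

seq-^ : ∀ x r m → seq (x ^ r) m ≡ seq x m ^ᵠ r
seq-^ x zero    m = refl
seq-^ x (suc r) m = cong (seq x m ℚ.*_) (seq-^ x r m)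

eventually-≤ : ∀ {x y} → ∃[ N ] (∀ m → N ℕ.≤ m → seq x m ℚ.≤ seq y m) → x ≤ y
eventually-≤ {x} {y} (N , h) = mk≤ λ ε ε>0 → N , λ m N≤m → ℚ.≤-<-trans (h m N≤m)
  (subst (ℚ._< seq y m ℚ.+ ε) (ℚ.+-identityʳ (seq y m)) (ℚ.+-monoʳ-< (seq y m) ε>0))

Sandwich : ℝ → ℚ → ℚ → Set
Sandwich ε u v = ∃[ N ] (∀ m → N ℕ.≤ m → ∣ 1ℚ ℚ.- seq ε m ∣ ℚ.≤ u × v ℚ.≤ 1ℚ ℚ.+ seq ε m)

-- For even r and ε > 2 the value 1 is outside [(1 - ε)^r, (1 + ε)^r], so the
-- coefficients are steered between u^r and v^r with ∣ 1 - ε ∣ ≤ u < v ≤ 1 + ε.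
sandwich : ∀ {ε} → 0ℝ < ε → ∃[ u ] ∃[ v ] 0ℚ ℚ.≤ u × u ℚ.< v × Sandwich ε u v
sandwich {ε} (mk< g g>0 (N₀ , ε>g)) with cauchy ε (g ℚ.⊓ ½) 0<η
  where
  0<η : 0ℚ ℚ.< g ℚ.⊓ ½
  0<η with ℚ.⊓-sel g ½
  ... | inj₁ eq = subst (0ℚ ℚ.<_) (sym eq) g>0
  ... | inj₂ eq = subst (0ℚ ℚ.<_) (sym eq) (ℚ.positive⁻¹ ½)
... | N₁ , close = ∣ 1ℚ ℚ.- q ∣ ℚ.+ η , 1ℚ ℚ.+ q ℚ.- η , 0≤u , u<v , N , λ m N≤m → lower m N≤m , upper m N≤m
  where
  open +-*-Solver
  -- The inequality u < v amounts to η < q when q ≤ 1 and to η < 1 when q ≥ 1. The gap `g` gives the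
  -- former and ½ the latter.
  η = g ℚ.⊓ ½
  N = N₀ ℕ.⊔ N₁
  q = seq ε N
  near : ∀ m → N ℕ.≤ m → ∣ q ℚ.- seq ε m ∣ ℚ.< η
  near m N≤m = close N m (ℕ.m≤n⊔m N₀ N₁) (ℕ.≤-trans (ℕ.m≤n⊔m N₀ N₁) N≤m)
  η<q : η ℚ.< q
  η<q = ℚ.≤-<-trans (ℚ.p⊓q≤p g ½) (subst (ℚ._< q) (ℚ.+-identityˡ g) (ε>g N (ℕ.m≤m⊔n N₀ N₁)))
  η<1 : η ℚ.< 1ℚ
  η<1 = ℚ.≤-<-trans (ℚ.p⊓q≤q g ½) (ℚ.*<* (ℤ.+<+ (s≤s (s≤s z≤n))))
  0≤u : 0ℚ ℚ.≤ ∣ 1ℚ ℚ.- q ∣ ℚ.+ η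
  0≤u = ℚ.≤-trans (ℚ.≤-trans (ℚ.0≤∣p∣ (q ℚ.- q)) (ℚ.<⇒≤ (near N ℕ.≤-refl)))
    (subst (ℚ._≤ ∣ 1ℚ ℚ.- q ∣ ℚ.+ η) (ℚ.+-identityˡ η) (ℚ.+-monoˡ-≤ η (ℚ.0≤∣p∣ (1ℚ ℚ.- q))))
  u<v : ∣ 1ℚ ℚ.- q ∣ ℚ.+ η ℚ.< 1ℚ ℚ.+ q ℚ.- η
  u<v with ℚ.∣p∣≡p∨∣p∣≡-p (1ℚ ℚ.- q)
  ... | inj₁ eq = subst₂ ℚ._<_ (trans (solve 3 (λ o q n → n :+ n :+ (o :- q :- n) := o :- q :+ n) refl 1ℚ q η) (cong (ℚ._+ η) (sym eq)))
    (solve 3 (λ o q n → q :+ q :+ (o :- q :- n) := o :+ q :- n) refl 1ℚ q η)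
    (ℚ.+-monoˡ-< (1ℚ ℚ.- q ℚ.- η) (ℚ.+-mono-< η<q η<q))
  ... | inj₂ eq = subst₂ ℚ._<_ (trans (solve 3 (λ o q n → n :+ n :+ (q :- o :- n) := :- (o :- q) :+ n) refl 1ℚ q η) (cong (ℚ._+ η) (sym eq)))
    (solve 3 (λ o q n → o :+ o :+ (q :- o :- n) := o :+ q :- n) refl 1ℚ q η)
    (ℚ.+-monoˡ-< (q ℚ.- 1ℚ ℚ.- η) (ℚ.+-mono-< η<1 η<1))
  lower : ∀ m → N ℕ.≤ m → ∣ 1ℚ ℚ.- seq ε m ∣ ℚ.≤ ∣ 1ℚ ℚ.- q ∣ ℚ.+ η
  lower m N≤m = ℚ.≤-trans (subst (λ x → ∣ x ∣ ℚ.≤ ∣ 1ℚ ℚ.- q ∣ ℚ.+ ∣ q ℚ.- seq ε m ∣)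
    (solve 3 (λ o q e → (o :- q) :+ (q :- e) := o :- e) refl 1ℚ q (seq ε m)) (ℚ.∣p+q∣≤∣p∣+∣q∣ (1ℚ ℚ.- q) (q ℚ.- seq ε m)))
    (ℚ.+-monoʳ-≤ ∣ 1ℚ ℚ.- q ∣ (ℚ.<⇒≤ (near m N≤m)))
  upper : ∀ m → N ℕ.≤ m → 1ℚ ℚ.+ q ℚ.- η ℚ.≤ 1ℚ ℚ.+ seq ε m
  upper m N≤m = subst₂ ℚ._≤_ (solve 4 (λ o q e n → q :- e :+ (o :+ e :- n) := o :+ q :- n) refl 1ℚ q (seq ε m) η)
    (solve 3 (λ o e n → n :+ (o :+ e :- n) := o :+ e) refl 1ℚ (seq ε m) η)
    (ℚ.+-monoˡ-≤ (1ℚ ℚ.+ seq ε m ℚ.- η) (ℚ.≤-trans (p≤∣p∣ (q ℚ.- seq ε m)) (ℚ.<⇒≤ (near m N≤m))))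

open MultinomialTheorem (CommutativeRing.commutativeSemiring ℝ-commutativeRing)
open ScaledCombination ℝ-commutativeRing
open import Algebra.Definitions.RawMonoid (CommutativeRing.+-rawMonoid ℝ-commutativeRing) using () renaming (_×_ to _·_)

form : ∀ {n} → ℝ → Vector ℕ n → LinearForm n
form y z = record
  { ⟦_⟧      = scaled y z
  ; isLinear = record
    { +ᴹ-isGroupHomomorphism = record
      { isMonoidHomomorphism = record
        { isMagmaHomomorphism = record
          { isRelHomomorphism = record { cong = scaled-cong y z }
          ; homo = scaled-+ y z
          }
        ; ε-homo = scaled-0 y z
        }
      ; ⁻¹-homo = scaled-neg y z
      }
    ; *ₗ-homo = scaled-* y z
    }
  }

seq-·1 : ∀ k m → seq (k · 1ℝ) m ≡ ι k
seq-·1 zero    m = refl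
seq-·1 (suc k) m = trans (cong (1ℚ ℚ.+_) (seq-·1 k m)) (sym (ι-+ 1 k))

-- The coefficients are constant sequences, so their bounds hold at every index and only ε needs a
-- threshold.
seq-coefficient : ∀ μ r k m → seq (fromℚ μ ^ r * (k · 1ℝ)) m ≡ μ ^ᵠ r ℚ.* ι k
seq-coefficient μ r k m = cong₂ ℚ._*_ (seq-^ (fromℚ μ) r m) (seq-·1 k m)

sandwich-^ : ∀ {ε u v y} r → 0ℚ ℚ.≤ v → Sandwich ε u v → (∀ m → u ^ᵠ r ℚ.≤ seq y m × seq y m ℚ.≤ v ^ᵠ r) →
             (1ℝ - ε) ^ r ≤ y × y ≤ (1ℝ + ε) ^ r
sandwich-^ {ε} {y = y} r 0≤v (N , h) b =
  eventually-≤ (N , λ m N≤m → subst (ℚ._≤ seq y m) (sym (seq-^ (1ℝ - ε) r m))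
    (ℚ.≤-trans (^-≤-∣∣ r (proj₁ (h m N≤m))) (proj₁ (b m)))) ,
  eventually-≤ (N , λ m N≤m → subst (seq y m ℚ.≤_) (sym (seq-^ (1ℝ + ε) r m))
    (ℚ.≤-trans (proj₂ (b m)) (^-mono-≤ r 0≤v (proj₂ (h m N≤m)))))

-- The constant 4 is a product of two factors 2: l + 1 ≤ 2 l because l ≥ 1, and l ≤ 2 ln n by
-- `lnSum-≥`.
number-of-forms : ∀ {c k l n} → 1 ℕ.≤ l → 2 ℕ.^ l ℕ.≤ n → k ℕ.≤ c ℕ.* suc l → fromℕ k ≤ fromℕ (4 ℕ.* c) * ln n
number-of-forms {c} {k} {l} {zero}  1≤l 2^l≤n k≤ with ℕ.≤-trans (ℕ.m^n>0 2 l) 2^l≤n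
... | ()
number-of-forms {c} {k} {l} {suc n} 1≤l 2^l≤n k≤ = eventually-≤ (0 , λ m _ → begin
  ι k                                    ≤⟨ /-mono k 0 (4 ℕ.* c ℕ.* l) 1 (ℕ.≤-trans (ℕ.*-monoˡ-≤ 2 k≤) count) ⟩
  + (4 ℕ.* c ℕ.* l) / 2                  ≡⟨ /-* (4 ℕ.* c) 0 l 1 ⟨
  ι (4 ℕ.* c) ℚ.* (+ l / 2)              ≤⟨ ℚ.*-monoˡ-≤-nonNeg (ι (4 ℕ.* c)) {{ℚ.nonNegative (/-nonNeg (4 ℕ.* c) 0)}} (lnSum-≥ l (suc n) m 2^l≤n) ⟩
  ι (4 ℕ.* c) ℚ.* lnSum (suc n) m        ∎)
  where
  open ℚ.≤-Reasoning
  count : c ℕ.* suc l ℕ.* 2 ℕ.≤ 4 ℕ.* c ℕ.* l ℕ.* 1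
  count = ℕ.≤-trans (ℕ.*-monoˡ-≤ 2 (ℕ.*-monoʳ-≤ c (ℕ.+-monoˡ-≤ l 1≤l)))
    (ℕ.≤-reflexive (solve 2 (λ c l → c :* (l :+ l) :* con 2 := con 4 :* c :* l :* con 1) refl c l))
    where open ℕ-Solver

fromℕ-pos : ∀ {n} → 1 ℕ.≤ n → 0ℝ < fromℕ n
fromℕ-pos {n} 1≤n = mk< ½ (ℚ.positive⁻¹ ½) (0 , λ _ _ → ℚ.<-≤-trans (ℚ.*<* (ℤ.+<+ (s≤s (s≤s z≤n)))) (ι-mono 1≤n))

private
  ι-*-^ : ∀ a b r → ι ((a ℕ.* b) ℕ.^ r) ≡ (ι a ℚ.* ι b) ^ᵠ r
  ι-*-^ a b r = trans (ι-^ (a ℕ.* b) r) (cong (_^ᵠ r) (ι-* a b))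

  ι-*-^-* : ∀ a b r H → ι ((a ℕ.* b) ℕ.^ r ℕ.* H) ≡ (ι a ℚ.* ι b) ^ᵠ r ℚ.* ι H
  ι-*-^-* a b r H = trans (ι-* ((a ℕ.* b) ℕ.^ r) H) (cong (ℚ._* ι H) (ι-*-^ a b r))

-- The scale `μ` is chosen before `H`, so that one scale serves the coefficients of all monomials.
design-scale : ∀ r {u v} s s′ Γ B → 0ℚ ℚ.≤ u → 0ℚ ℚ.≤ v → u ℚ.* (ι s′ ℚ.* ι s′) ℚ.≤ v ℚ.* (ι s ℚ.* ι s) →
  1 ℕ.≤ s′ → 1 ℕ.≤ Γ → ∃[ μ ] (∀ H → (s ℕ.* Γ) ℕ.^ r ℕ.≤ (s′ ℕ.* B) ℕ.^ r ℕ.* H →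
    (s ℕ.* B) ℕ.^ r ℕ.* H ℕ.≤ (s′ ℕ.* Γ) ℕ.^ r → u ^ᵠ r ℚ.≤ μ ^ᵠ r ℚ.* ι H × μ ^ᵠ r ℚ.* ι H ℚ.≤ v ^ᵠ r)
design-scale r {u} {v} s s′ Γ B 0≤u 0≤v gap 1≤s′ 1≤Γ =
  μ , λ H lo hi → rescale r {β = ι B} {μ = μ} 0≤u 0≤v (/-nonNeg s 0) (ι-pos 1≤s′) (ι-pos 1≤Γ) μ≡ gap
    (subst₂ ℚ._≤_ (ι-*-^ s Γ r) (ι-*-^-* s′ B r H) (ι-mono {(s ℕ.* Γ) ℕ.^ r} {(s′ ℕ.* B) ℕ.^ r ℕ.* H} lo))
    (subst₂ ℚ._≤_ (ι-*-^-* s B r H) (ι-*-^ s′ Γ r) (ι-mono {(s ℕ.* B) ℕ.^ r ℕ.* H} {(s′ ℕ.* Γ) ℕ.^ r} hi))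
  where
  0<s′Γ : 0ℚ ℚ.< ι s′ ℚ.* ι Γ
  0<s′Γ = subst (0ℚ ℚ.<_) (ι-* s′ Γ) (ι-pos (ℕ.*-mono-≤ 1≤s′ 1≤Γ))
  quotient = divide (ι s′ ℚ.* ι Γ) (v ℚ.* (ι s ℚ.* ι B)) 0<s′Γ
  μ = proj₁ quotient
  μ≡ = proj₂ quotient

polynomial-identity : ∀ {n} r y (zs : List (Vector ℕ n)) (x : Vector ℝ n) →
  sum (λ i → ⟦ form y (List.lookup zs i) ⟧ x ^ r) ≈ homogeneous r (λ a → y ^ r * (coefficient zs a · 1ℝ)) x
polynomial-identity {n} r y zs x = subst (_≈ homogeneous r (λ a → y ^ r * (coefficient zs a · 1ℝ)) x)
  (sym (sum-lookup (λ z → scaled y z x ^ r) zs)) (sumOfPowers n r y zs x)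

coefficient-bounds : ∀ {ε u v μ} r H → 0ℚ ℚ.≤ v → Sandwich ε u v → u ^ᵠ r ℚ.≤ μ ^ᵠ r ℚ.* ι H × μ ^ᵠ r ℚ.* ι H ℚ.≤ v ^ᵠ r →
  (1ℝ - ε) ^ r ≤ fromℚ μ ^ r * (H · 1ℝ) × fromℚ μ ^ r * (H · 1ℝ) ≤ (1ℝ + ε) ^ r
coefficient-bounds {ε} {u} {v} {μ} r H 0≤v sandwiched bounds = sandwich-^ {y = fromℚ μ ^ r * (H · 1ℝ)} r 0≤v sandwiched λ m →
  subst (λ y → u ^ᵠ r ℚ.≤ y × y ℚ.≤ v ^ᵠ r) (sym (seq-coefficient μ r H m)) bounds

theorem1p3 : (r : ℕ) → 1 ℕ.≤ r → (ε : ℝ) → 0ℝ < ε →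
    ∃[ κ ] 0ℝ < κ ×
    ((n : ℕ) → 2 ℕ.≤ n →
    ∃[ k ] fromℕ k ≤ κ * ln n ×
    (Σ[ ℓ ∈ Vector (LinearForm n) k ] Σ[ h ∈ (Vec ℕ n → ℝ) ]
    ((x : Vector ℝ n) → sum (λ i → ⟦ ℓ i ⟧ x ^ r) ≈ homogeneous r h x) ×
    ((a : Vec ℕ n) → Vec.sum a ≡ r →
    (1ℝ - ε) ^ r ≤ h a × h a ≤ (1ℝ + ε) ^ r)))
theorem1p3 r 1≤r ε ε>0 =
  let u , v , 0≤u , u<v , sandwiched = sandwich ε>0
      0≤v = ℚ.≤-trans 0≤u (ℚ.<⇒≤ u<v)
      t , 1≤t , gap = precision 0≤u u<v
      G , B , c , 1≤G , 1≤B , 1≤c , designs = design r t 1≤r 1≤t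
  in fromℕ (4 ℕ.* c) , fromℕ-pos (ℕ.*-mono-≤ (s≤s (z≤n {3})) 1≤c) , λ n 2≤n →
  let l , 1≤l , 2^l≤n , n<2^1+l = log₂ n 2≤n
      -- The exponent is `suc l` because the code needs n ≤ 2^L, whereas 2^l only bounds `n` from
      -- below.
      q , zs , 1≤q , few , bounds = designs n (suc l) (s≤s z≤n) (ℕ.<⇒≤ n<2^1+l)
      μ , scale = design-scale r t (suc t) (G ℕ.* q) B 0≤u 0≤v gap (s≤s z≤n) (ℕ.*-mono-≤ 1≤G 1≤q)
  in length zs , number-of-forms {c} 1≤l 2^l≤n few ,
     (λ i → form (fromℚ μ) (List.lookup zs i)) , (λ a → fromℚ μ ^ r * (coefficient zs a · 1ℝ)) ,
     polynomial-identity r (fromℚ μ) zs ,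
     λ a |a|≡r → coefficient-bounds r (coefficient zs a) 0≤v sandwiched
       (scale (coefficient zs a) (proj₁ (bounds a |a|≡r)) (proj₂ (bounds a |a|≡r)))
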